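{- Let $i\in\{1,2\}$ and let $m,n$ be positive integers with $n>m\ge 5$ and $m-1\nmid (n-3)$. Then $m+n-5\le r(T_m^i,T_n')\le m+n-4$ and $m+n-6\le r(T_m^i,T_n^*)\le m+n-4$. Moreover, write $n=k(m-1)+b=q(m-2)+a$ with $k,q$ positive integers, $a\in\{0,1,\ldots,m-3\}$ and $b\in\{0,1,\ldots,m-2\}$. If one of the conditions (1) $b\in\{1,2,4\}$; (2) $b=0$ and $k\ge 3$; (3) $n\ge (m-3)^2+2$; (4) $n\ge m^2-1-b(m-2)$; (5) $a\ge 3$ and $n\ge (a-4)(m-1)+4$ holds, then $r(T_m^i,T_n^*)=r(T_m^i,T_n')=m+n-4$.
   Context: All graphs are finite and simple. For graphs $G_1,G_2$, the Ramsey number $r(G_1,G_2)$ is the smallest positive integer $N$ such that for every graph $G$ on $N$ vertices, either $G$ contains a subgraph isomorphic to $G_1$ or the complement $\overline G$ contains a subgraph isomorphic to $G_2$. $T_m^1$ is the tree with vertex set $\{v_0,\ldots,v_{m-1}\}$ and edge set $\{v_0v_1,\ldots,v_0v_{m-3},v_{m-4}v_{m-2},v_{m-3}v_{m-1}\}$; $T_m^2$ is the tree with the same vertex set and edge set $\{v_0v_1,\ldots,v_0v_{m-3},v_{m-3}v_{m-2},v_{m-3}v_{m-1}\}$. $T_n'$ is the unique (up to isomorphism) tree on $n$ vertices with maximum degree $n-2$. $T_n^*$ is the tree with vertex set $\{v_0,\ldots,v_{n-1}\}$ and edge set $\{v_0v_1,\ldots,v_0v_{n-3},v_{n-3}v_{n-2},v_{n-2}v_{n-1}\}$.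 -}

module Defs where

open import Data.Nat using (ℕ; zero; suc; _+_; _*_; _∸_; _≤_; _<_)
open import Data.Fin using (Fin; toℕ; _≟_)
open import Data.Bool using (Bool; true; false; not; if_then_else_)
open import Data.Product using (Σ; _×_; _,_)
open import Data.Sum using (_⊎_)
open import Relation.Nullary using (¬_; does)
open import Relation.Binary.PropositionalEquality using (_≡_)
open import Function.Definitions using (Injective)

record Graph (N : ℕ) : Set where
  field
    adj   : Fin N → Fin N → Bool
    sym   : ∀ i j → adj i j ≡ adj j i
    irref : ∀ i → adj i i ≡ false
open Graph public

complement : {N : ℕ} → Graph N → Graph N
complement G = record
  { adj   = λ i j → if does (i ≟ j) then false else not (adj G i j)
  ; sym   = symC
  ; irref = irrC }
  where
  open import Relation.Nullary using (yes; no)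
  open import Relation.Binary.PropositionalEquality using (refl; cong) renaming (sym to ≡-sym)
  symC : ∀ i j → (if does (i ≟ j) then false else not (adj G i j))
                ≡ (if does (j ≟ i) then false else not (adj G j i))
  symC i j with i ≟ j | j ≟ i
  ... | yes _ | yes _ = refl
  ... | yes p | no q = Data.Empty.⊥-elim (q (≡-sym p)) where import Data.Empty
  ... | no p | yes q = Data.Empty.⊥-elim (p (≡-sym q)) where import Data.Empty
  ... | no _ | no _ = cong not (Graph.sym G i j)
  irrC : ∀ i → (if does (i ≟ i) then false else not (adj G i i)) ≡ false
  irrC i with i ≟ i
  ... | yes _ = refl
  ... | no p = Data.Empty.⊥-elim (p refl) where import Data.Empty

-- A (small) graph H on vertices v_0,...,v_{k-1} is given by its number of vertices k
-- and an edge predicate E on indices (each edge listed in at least one orientation).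
record Pattern : Set₁ where
  constructor mkPattern
  field
    size : ℕ
    E    : ℕ → ℕ → Set
open Pattern public

Contains : {N : ℕ} → Graph N → Pattern → Set
Contains {N} G H =
  Σ (Fin (size H) → Fin N) λ f →
    Injective _≡_ _≡_ f × (∀ i j → E H (toℕ i) (toℕ j) → adj G (f i) (f j) ≡ true)

Arrows : ℕ → Pattern → Pattern → Set
Arrows N H₁ H₂ = (G : Graph N) → Contains G H₁ ⊎ Contains (complement G) H₂

IsRamseyNumber : Pattern → Pattern → ℕ → Set
IsRamseyNumber H₁ H₂ R =
  1 ≤ R × Arrows R H₁ H₂ × (∀ M → 1 ≤ M → M < R → ¬ Arrows M H₁ H₂)

T1 : ℕ → Pattern
T1 m = mkPattern m (λ x y →
    (x ≡ 0 × 1 ≤ y × y ≤ m ∸ 3)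
  ⊎ (x ≡ m ∸ 4 × y ≡ m ∸ 2)
  ⊎ (x ≡ m ∸ 3 × y ≡ m ∸ 1))

T2 : ℕ → Pattern
T2 m = mkPattern m (λ x y →
    (x ≡ 0 × 1 ≤ y × y ≤ m ∸ 3)
  ⊎ (x ≡ m ∸ 3 × y ≡ m ∸ 2)
  ⊎ (x ≡ m ∸ 3 × y ≡ m ∸ 1))

Tmi : Fin 2 → ℕ → Pattern
Tmi Fin.zero m = T1 m
Tmi (Fin.suc _) m = T2 m

-- T_n' : the tree on n vertices with maximum degree n-2, realised concretely as
-- edges v0v1,...,v0v_{n-2}, v_{n-2}v_{n-1}
T' : ℕ → Pattern
T' n = mkPattern n (λ x y →
    (x ≡ 0 × 1 ≤ y × y ≤ n ∸ 2)
  ⊎ (x ≡ n ∸ 2 × y ≡ n ∸ 1))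

T* : ℕ → Pattern
T* n = mkPattern n (λ x y →
    (x ≡ 0 × 1 ≤ y × y ≤ n ∸ 3)
  ⊎ (x ≡ n ∸ 3 × y ≡ n ∸ 2)
  ⊎ (x ≡ n ∸ 2 × y ≡ n ∸ 1))

{-# OPTIONS --safe #-}
-- Upper bounds: let G have m + n − 4 vertices. If all degrees are at least m − 2, two vertices
-- at distance 2 yield a copy of T_m^i; otherwise G is a disjoint union of cliques, which either
-- have order m − 1, contradicting m − 1 ∤ n − 3, or contain T_m^i. So some vertex v has degree at
-- most m − 3, hence at least n − 2 non-neighbours A. Either the complement has an edge (a path)
-- leaving v's star that completes T_n' (T_n*), or G is almost complete on A or almost complete
-- bipartite between A and the neighbours of v, and contains T_m^i.
--
-- Lower bounds: a disjoint union of cliques K_{m−1} and K_{m−2} on m + n − 5 vertices contains no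
-- T_m^i, and every vertex has at most n − 3 non-neighbours, so few that T_n' and T_n* do not fit
-- in the complement. Each of the conditions (1)–(5) writes m + n − 5 as x(m − 1) + y(m − 2). Without
-- them, a clique together with an (m − 4)-regular graph gives the weaker bounds. Deciding the
-- arrow relation by exhaustive search then locates the Ramsey number between the bounds.
module Submission where

open import Defs
open import Data.Bool using (Bool; true; false; not; _∧_; if_then_else_)
open import Data.Bool.Properties using (¬-not)
import Data.Bool.Properties as Bool
open import Data.Empty using (⊥)
open import Data.Fin using (Fin; toℕ; _≟_; _↑ˡ_; _↑ʳ_; splitAt; fromℕ<; inject≤)
open import Data.Fin.Properties
  using (toℕ<n; toℕ-injective; toℕ-fromℕ<; toℕ-inject≤; inject≤-injective; suc-injective; any?; all?;
         splitAt-↑ˡ; splitAt-↑ʳ; splitAt⁻¹-↑ˡ; splitAt⁻¹-↑ʳ; ↑ˡ-injective; ↑ʳ-injective; injective⇒≤)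
open import Data.List
  using (List; []; _∷_; _++_; length; filter; take; map; tabulate; applyUpTo; allFin)
open import Data.List.Properties
  using (length-take; length-++; length-map; length-tabulate; length-applyUpTo; length-filter; ++-assoc)
open import Data.List.Membership.Propositional using (_∈_; _∉_)
open import Data.List.Membership.Propositional.Properties
  using (∈-∃++; ∈-++⁺ˡ; ∈-++⁺ʳ; ∈-++⁻; ∈-filter⁺; ∈-filter⁻; ∈-allFin;
         ∈-tabulate⁻; ∈-applyUpTo⁺; ∈-upTo⁺)
open import Data.List.Relation.Binary.Subset.Propositional using (_⊆_)
open import Data.List.Relation.Unary.All as All using (All; []; _∷_)
import Data.List.Relation.Unary.All.Properties as All
open import Data.List.Relation.Unary.AllPairs using ([]; _∷_)
open import Data.List.Relation.Unary.Any using (here; there)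
open import Data.List.Relation.Unary.Unique.Propositional using (Unique)
import Data.List.Relation.Unary.Unique.Propositional.Properties as Unique
import Data.Nat as ℕ
open import Data.Nat using (ℕ; zero; suc; _+_; _*_; _∸_; _≤_; _<_; _≥_; z≤n; s≤s)
open import Data.Nat.Divisibility
  using (_∣_; _∣0; ∣-refl; n∣m*n; ∣n⇒∣m*n; ∣m∣n⇒∣m+n; ∣m+n∣m⇒∣n; >⇒∤)
open import Data.Nat.DivMod using (_%_; _/_; m≡m%n+[m/n]*n; m%n<n; /-mono-≤; m*n/n≡m)
open import Data.Nat.Properties hiding (_≟_; suc-injective)
open import Data.Nat.Tactic.RingSolver using (solve-∀)
open import Data.Product using (Σ; ∃; ∃-syntax; _×_; _,_; proj₁; proj₂)
open import Data.Sum using (_⊎_; inj₁; inj₂) renaming ([_,_]′ to [_,_])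
import Data.Vec as Vec
open import Data.Vec using (Vec; []; _∷_; lookup)
open import Data.Vec.Properties using (lookup∘tabulate)
open import Function using (_∘_; id)
open import Function.Definitions using (Injective)
open import Relation.Binary using (DecidableEquality)
open import Relation.Binary.PropositionalEquality
  using (_≡_; _≢_; refl; trans; cong; cong₂; subst; subst₂; module ≡-Reasoning)
  renaming (sym to ≡-sym)
open import Relation.Nullary
  using (¬_; Dec; yes; no; does; contradiction; ¬?; _×-dec_; _⊎-dec_; _→-dec_)
open import Relation.Nullary.Decidable using (dec-true; map′)
open import Relation.Unary using (Decidable)

-- Lists without repetition

private variable
  A : Set

module _ {A B : Set} (h : A → B) where
  -- The pigeonhole principle by induction on `xs`: one occurrence of `h x` is deleted from `ys`,
  -- and injectivity keeps the images of the other elements inside what is left.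
  injection-length : ∀ {xs ys} → Unique xs →
    (∀ {x y} → x ∈ xs → y ∈ xs → h x ≡ h y → x ≡ y) →
    (∀ {x} → x ∈ xs → h x ∈ ys) → length xs ≤ length ys
  injection-length {[]} _ _ _ = z≤n
  injection-length {x ∷ xs} (x∉ ∷ u) inj into with ∈-∃++ (into (here refl))
  ... | as , bs , refl = begin
    suc (length xs)              ≤⟨ s≤s (injection-length u (λ p q → inj (there p) (there q)) into′) ⟩
    suc (length (as ++ bs))      ≡⟨ cong suc (length-++ as) ⟩
    suc (length as + length bs)  ≡⟨ +-suc _ _ ⟨
    length as + suc (length bs)  ≡⟨ length-++ as ⟨
    length (as ++ h x ∷ bs)      ∎
    where
    open ≤-Reasoning
    into′ : ∀ {y} → y ∈ xs → h y ∈ as ++ bs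
    into′ {y} y∈ with ∈-++⁻ as (into (there y∈))
    ... | inj₁ p = ∈-++⁺ˡ p
    ... | inj₂ (here eq) =
      contradiction (≡-sym (inj (there y∈) (here refl) eq)) (All.lookup x∉ y∈)
    ... | inj₂ (there p) = ∈-++⁺ʳ as p

⊆-length : {xs ys : List A} → Unique xs → xs ⊆ ys → length xs ≤ length ys
⊆-length u sub = injection-length id u (λ _ _ eq → eq) sub

unique-length≤ : ∀ {N} {xs : List (Fin N)} → Unique xs → length xs ≤ N
unique-length≤ {N} {xs} u =
  subst (length xs ≤_) (length-tabulate {n = N} id) (⊆-length u (λ {x} _ → ∈-allFin x))

module _ (_≟_ : DecidableEquality A) where
  open import Data.List.Membership.DecPropositional _≟_ using (_∈?_)

  -- As `as` has no repetition, filtering out `fs` costs at most `length fs` elements, so the first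
  -- `k` survivors will do.
  pick : ∀ k {as : List A} → Unique as → (fs : List A) → k + length fs ≤ length as →
    ∃[ ls ] length ls ≡ k × Unique ls × (∀ {x} → x ∈ ls → x ∈ as × x ∉ fs)
  pick k {as} u fs le = take k rest , length-rest , Unique.take⁺ k (Unique.filter⁺ avoids u) ,
    λ x∈ → ∈-filter⁻ avoids (take-⊆ k rest x∈)
    where
    avoids : Decidable (_∉ fs)
    avoids x = ¬? (x ∈? fs)
    rest = filter avoids as
    covered : as ⊆ rest ++ fs
    covered {x} x∈ with x ∈? fs
    ... | yes p = ∈-++⁺ʳ rest p
    ... | no ¬p = ∈-++⁺ˡ (∈-filter⁺ avoids x∈ ¬p)
    enough : k ≤ length rest
    enough = +-cancelʳ-≤ (length fs) k (length rest)
      (≤-trans le (subst (length as ≤_) (length-++ rest) (⊆-length u covered)))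
    length-rest : length (take k rest) ≡ k
    length-rest = trans (length-take k rest) (m≤n⇒m⊓n≡m enough)
    take-⊆ : ∀ k (xs : List A) → take k xs ⊆ xs
    take-⊆ (suc k) (x ∷ xs) (here eq) = here eq
    take-⊆ (suc k) (x ∷ xs) (there p) = there (take-⊆ k xs p)

  pick₁ : ∀ {as : List A} → Unique as → (fs : List A) → 1 + length fs ≤ length as →
    ∃[ x ] x ∈ as × x ∉ fs
  pick₁ u fs le with pick 1 u fs le
  ... | x ∷ [] , refl , _ , spec = x , spec (here refl)

  pick₂ : ∀ {as : List A} → Unique as → (fs : List A) → 2 + length fs ≤ length as →
    ∃[ x ] ∃[ y ] x ≢ y × (x ∈ as × x ∉ fs) × (y ∈ as × y ∉ fs)
  pick₂ u fs le with pick 2 u fs le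
  ... | x ∷ y ∷ [] , refl , (x≢y ∷ []) ∷ _ , spec =
    x , y , x≢y , spec (here refl) , spec (there (here refl))

  pick₃ : ∀ {as : List A} → Unique as → (fs : List A) → 3 + length fs ≤ length as →
    ∃[ x ] ∃[ y ] ∃[ z ] (x ≢ y × x ≢ z × y ≢ z)
      × (x ∈ as × x ∉ fs) × (y ∈ as × y ∉ fs) × (z ∈ as × z ∉ fs)
  pick₃ u fs le with pick 3 u fs le
  ... | x ∷ y ∷ z ∷ [] , refl , (x≢y ∷ x≢z ∷ []) ∷ (y≢z ∷ []) ∷ _ , spec =
    x , y , z , (x≢y , x≢z , y≢z) ,
    spec (here refl) , spec (there (here refl)) , spec (there (there (here refl)))

module _ {A : Set} {P Q : A → Set} (P? : Decidable P) (Q? : Decidable Q) where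
  filter-filter : (∀ {x} → P x → Q x) → ∀ xs → filter P? (filter Q? xs) ≡ filter P? xs
  filter-filter P⇒Q [] = refl
  filter-filter P⇒Q (x ∷ xs) with Q? x | P? x in eq
  ... | yes _ | yes _ rewrite eq = cong (x ∷_) (filter-filter P⇒Q xs)
  ... | yes _ | no _ rewrite eq = filter-filter P⇒Q xs
  ... | no ¬q | yes p = contradiction (P⇒Q p) ¬q
  ... | no _ | no _ = filter-filter P⇒Q xs

length-filter-¬ : {P : A → Set} (P? : Decidable P) (xs : List A) →
  length xs ≡ length (filter P? xs) + length (filter (¬? ∘ P?) xs)
length-filter-¬ P? [] = refl
length-filter-¬ P? (x ∷ xs) with P? x
... | yes _ = cong suc (length-filter-¬ P? xs)
... | no _ = trans (cong suc (length-filter-¬ P? xs)) (≡-sym (+-suc _ _))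

module _ {A : Set} {_~_ : A → A → Set} (_~?_ : ∀ x y → Dec (x ~ y))
  (~-refl : ∀ {x} → x ~ x) (~-sym : ∀ {x y} → x ~ y → y ~ x)
  (~-trans : ∀ {x y z} → x ~ y → y ~ z → x ~ z) where

  -- Removing the whole class of the first element takes away `c` elements and leaves every other
  -- class intact, so the same argument applies to the remainder. The recursion runs on a bound for
  -- the length because the remainder is a filtered list.
  classSize∣length : ∀ c (xs : List A) →
    (∀ {x} → x ∈ xs → length (filter (x ~?_) xs) ≡ c) → c ∣ length xs
  classSize∣length c xs₀ = go (length xs₀) xs₀ ≤-refl
    where
    go : ∀ bound (xs : List A) → length xs ≤ bound →
      (∀ {x} → x ∈ xs → length (filter (x ~?_) xs) ≡ c) → c ∣ length xs
    go _ [] _ _ = c ∣0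
    go (suc bound) xs@(x ∷ xs′) le size =
      subst (c ∣_) (≡-sym (length-filter-¬ (x ~?_) xs))
        (∣m∣n⇒∣m+n (subst (c ∣_) (≡-sym (size (here refl))) ∣-refl) (go bound rest shorter size′))
      where
      rest = filter (¬? ∘ (x ~?_)) xs
      shorter : length rest ≤ bound
      shorter with x ~? x
      ... | yes _ = ≤-trans (length-filter (¬? ∘ (x ~?_)) xs′) (≤-pred le)
      ... | no ¬r = contradiction ~-refl ¬r
      size′ : ∀ {y} → y ∈ rest → length (filter (y ~?_) rest) ≡ c
      size′ {y} y∈ with ∈-filter⁻ (¬? ∘ (x ~?_)) y∈
      ... | y∈xs , x≁y = trans
        (cong length (filter-filter (y ~?_) (¬? ∘ (x ~?_))
          (λ y~z x~z → x≁y (~-trans x~z (~-sym y~z))) xs))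
        (size y∈xs)

module _ {A : Set} (d : A) where
  -- The default `d` makes lookup total, so that copies can be described by the plain natural-number
  -- indices that `Pattern` uses.
  at : List A → ℕ → A
  at [] _ = d
  at (x ∷ _) zero = x
  at (_ ∷ xs) (suc k) = at xs k

  at-++ʳ : ∀ xs ys k → at (xs ++ ys) (k + length xs) ≡ at ys k
  at-++ʳ xs ys k = trans (cong (at (xs ++ ys)) (+-comm k (length xs))) (go xs)
    where
    go : ∀ xs → at (xs ++ ys) (length xs + k) ≡ at ys k
    go [] = refl
    go (_ ∷ xs) = go xs

  at-++ˡ : ∀ {xs} ys {k} → k < length xs → at (xs ++ ys) k ∈ xs
  at-++ˡ {_ ∷ xs} ys {zero} _ = here refl
  at-++ˡ {_ ∷ xs} ys {suc k} (s≤s lt) = there (at-++ˡ ys lt)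

  at-∈ : ∀ {xs k} → k < length xs → at xs k ∈ xs
  at-∈ {_ ∷ xs} {zero} _ = here refl
  at-∈ {_ ∷ xs} {suc k} (s≤s lt) = there (at-∈ lt)

  at-injective : ∀ {xs} → Unique xs → ∀ {i j} → i < length xs → j < length xs →
    at xs i ≡ at xs j → i ≡ j
  at-injective {_ ∷ _} _ {zero} {zero} _ _ _ = refl
  at-injective {_ ∷ _} (x∉ ∷ _) {zero} {suc j} _ (s≤s q) eq =
    contradiction eq (All.lookup x∉ (at-∈ q))
  at-injective {_ ∷ _} (x∉ ∷ _) {suc i} {zero} (s≤s p) _ eq =
    contradiction (≡-sym eq) (All.lookup x∉ (at-∈ p))
  at-injective {_ ∷ _} (_ ∷ u) {suc i} {suc j} (s≤s p) (s≤s q) eq = cong suc (at-injective u p q eq)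

-- Copies of trees grown from a star

module Embed {N : ℕ} (G : Graph N) where
  infix 4 _~_
  _~_ : Fin N → Fin N → Set
  u ~ v = adj G u v ≡ true

  ~-sym : ∀ {u v} → u ~ v → v ~ u
  ~-sym {u} {v} e = trans (Graph.sym G v u) e

  ~⇒≢ : ∀ {u v} → u ~ v → u ≢ v
  ~⇒≢ {u} e refl = contradiction (trans (≡-sym e) (irref G u)) λ ()

  listCopy : ∀ {k R} d xs → Unique xs → length xs ≡ k →
    (∀ {i j} → R i j → at d xs i ~ at d xs j) → Contains G (mkPattern k R)
  listCopy d xs u refl edge = (λ i → at d xs (toℕ i)) ,
    (λ {i} {j} eq → toℕ-injective (at-injective d u (toℕ<n i) (toℕ<n j) eq)) ,
    λ i j e → edge e

  -- A copy of a tree whose root v is joined to k unnamed leaves (taken from as) and to ms₁,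
  -- in this order; ms₂ lists its remaining vertices, and fs those named vertices that lie in as.
  module _ {v as} (u : Unique as) (v~ : ∀ {x} → x ∈ as → v ~ x) where

    treeCopy : ∀ k ms₁ ms₂ fs → Unique (v ∷ ms₁ ++ ms₂) → All (v ~_) ms₁ →
      All (λ x → x ∈ as → x ∈ fs) (ms₁ ++ ms₂) → k + length fs ≤ length as → ∀ {R} →
      (∀ {i j} → R i j → (i ≡ 0 × 1 ≤ j × j ≤ length ms₁ + k)
        ⊎ (∃[ s ] ∃[ t ] i ≡ suc (s + k) × j ≡ suc (t + k)
            × at v (ms₁ ++ ms₂) s ~ at v (ms₁ ++ ms₂) t)) →
      Contains G (mkPattern (suc (length (ms₁ ++ ms₂) + k)) R)
    -- The images are listed as root, leaves, `ms₁`, `ms₂`, so entry `s` of `ms` is tree vertex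
    -- `suc (s + k)`. Leaves that avoid `fs` avoid every named vertex, by `avoid`.
    treeCopy k ms₁ ms₂ fs (v∉ ∷ ums) v~ms₁ avoid le {R} edges with pick _≟_ k u fs le
    ... | ls , refl , uls , ls-spec = listCopy {R = R} v (v ∷ ls ++ ms)
      (All.++⁺ (All.tabulate (λ x∈ → ~⇒≢ (v~ (proj₁ (ls-spec x∈))))) v∉
        ∷ Unique.++⁺ uls ums (λ (x∈ls , x∈ms) →
            proj₂ (ls-spec x∈ls) (All.lookup avoid x∈ms (proj₁ (ls-spec x∈ls)))))
      (cong suc (trans (length-++ ls) (+-comm (length ls) _)))
      edge
      where
      ms = ms₁ ++ ms₂
      leaf : ∀ {y} → y < length ms₁ + length ls → v ~ at v (ls ++ ms) y
      leaf {y} lt with ∈-++⁻ ls (subst (λ zs → at v zs y ∈ ls ++ ms₁) (++-assoc ls ms₁ ms₂)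
                         (at-++ˡ v ms₂ (subst (y <_)
                           (≡-sym (trans (length-++ ls) (+-comm (length ls) _))) lt)))
      ... | inj₁ p = v~ (proj₁ (ls-spec p))
      ... | inj₂ p = All.lookup v~ms₁ p
      edge : ∀ {i j} → R i j → at v (v ∷ ls ++ ms) i ~ at v (v ∷ ls ++ ms) j
      edge r with edges r
      ... | inj₁ (refl , s≤s _ , le′) = leaf le′
      ... | inj₂ (s , t , refl , refl , e) =
        subst₂ _~_ (≡-sym (at-++ʳ v ls ms s)) (≡-sym (at-++ʳ v ls ms t)) e

    -- Throughout, m = 5 + k, so that the truncated subtractions in the patterns compute.
    T1-copy : ∀ k {a b p q} fs → Unique (v ∷ a ∷ b ∷ p ∷ q ∷ []) → v ~ a → v ~ b → a ~ p → b ~ q →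
      All (λ x → x ∈ as → x ∈ fs) (a ∷ b ∷ p ∷ q ∷ []) → k + length fs ≤ length as →
      Contains G (T1 (5 + k))
    T1-copy k {a} {b} {p} {q} fs un va vb ap bq avoid le =
      treeCopy k (a ∷ b ∷ []) (p ∷ q ∷ []) fs un (va ∷ vb ∷ []) avoid le {E (T1 (5 + k))} λ where
        (inj₁ e) → inj₁ e
        (inj₂ (inj₁ (i≡ , j≡))) → inj₂ (0 , 2 , i≡ , j≡ , ap)
        (inj₂ (inj₂ (i≡ , j≡))) → inj₂ (1 , 3 , i≡ , j≡ , bq)

    T2-copy : ∀ k {a p q} fs → Unique (v ∷ a ∷ p ∷ q ∷ []) → v ~ a → a ~ p → a ~ q →
      All (λ x → x ∈ as → x ∈ fs) (a ∷ p ∷ q ∷ []) → suc k + length fs ≤ length as →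
      Contains G (T2 (5 + k))
    T2-copy k {a} {p} {q} fs un va ap aq avoid le =
      treeCopy (suc k) (a ∷ []) (p ∷ q ∷ []) fs un (va ∷ []) avoid le {E (T2 (5 + k))} λ where
        (inj₁ e) → inj₁ e
        (inj₂ (inj₁ (i≡ , j≡))) → inj₂ (0 , 1 , i≡ , j≡ , ap)
        (inj₂ (inj₂ (i≡ , j≡))) → inj₂ (0 , 2 , i≡ , j≡ , aq)

    -- Here `k` again counts the unnamed leaves, so that `n = 3 + k`; for `T*` below, `n = 4 + k`.
    T'-copy : ∀ k {a p} fs → Unique (v ∷ a ∷ p ∷ []) → v ~ a → a ~ p →
      All (λ x → x ∈ as → x ∈ fs) (a ∷ p ∷ []) → k + length fs ≤ length as →
      Contains G (T' (3 + k))
    T'-copy k {a} {p} fs un va ap avoid le =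
      treeCopy k (a ∷ []) (p ∷ []) fs un (va ∷ []) avoid le {E (T' (3 + k))} λ where
        (inj₁ e) → inj₁ e
        (inj₂ (i≡ , j≡)) → inj₂ (0 , 1 , i≡ , j≡ , ap)

    T*-copy : ∀ k {a x y} fs → Unique (v ∷ a ∷ x ∷ y ∷ []) → v ~ a → a ~ x → x ~ y →
      All (λ x → x ∈ as → x ∈ fs) (a ∷ x ∷ y ∷ []) → k + length fs ≤ length as →
      Contains G (T* (4 + k))
    T*-copy k {a} {x} {y} fs un va ax xy avoid le =
      treeCopy k (a ∷ []) (x ∷ y ∷ []) fs un (va ∷ []) avoid le {E (T* (4 + k))} λ where
        (inj₁ e) → inj₁ e
        (inj₂ (inj₁ (i≡ , j≡))) → inj₂ (0 , 1 , i≡ , j≡ , ax)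
        (inj₂ (inj₂ (i≡ , j≡))) → inj₂ (1 , 2 , i≡ , j≡ , xy)

-- Neighbourhoods, and configurations that force a copy of the tree

nbrs : ∀ {N} → Graph N → Fin N → List (Fin N)
nbrs {N} G v = filter (λ u → adj G v u Bool.≟ true) (allFin N)

nbrs-unique : ∀ {N} (G : Graph N) v → Unique (nbrs G v)
nbrs-unique {N} G v = Unique.filter⁺ (λ u → adj G v u Bool.≟ true) (Unique.allFin⁺ N)

module _ {N} (G : Graph N) where
  open Embed G

  ∈-nbrs⁺ : ∀ {u v} → v ~ u → u ∈ nbrs G v
  ∈-nbrs⁺ e = ∈-filter⁺ _ (∈-allFin _) e

  ∈-nbrs⁻ : ∀ {u v} → u ∈ nbrs G v → v ~ u
  ∈-nbrs⁻ p = proj₂ (∈-filter⁻ _ {xs = allFin N} p)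

  clique⇒tree : ∀ i k xs → Unique xs → (∀ {x y} → x ∈ xs → y ∈ xs → x ≢ y → x ~ y) →
    5 + k ≤ length xs → Contains G (Tmi i (5 + k))
  clique⇒tree i k (v ∷ as@(a ∷ b ∷ p ∷ q ∷ rest)) u@(v∉ ∷ uas) joined
    (s≤s le@(s≤s (s≤s (s≤s (s≤s _))))) = go i
    where
    v~as : ∀ {x} → x ∈ as → v ~ x
    v~as x∈ = joined (here refl) (there x∈) (All.lookup v∉ x∈)
    go : ∀ i → Contains G (Tmi i (5 + k))
    go Fin.zero with Unique.take⁺ 5 u
    ... | u₅@(_ ∷ (_ ∷ a≢p ∷ _) ∷ (_ ∷ b≢q ∷ _) ∷ _) =
      T1-copy uas v~as k (a ∷ b ∷ p ∷ q ∷ []) u₅ (v~as (here refl)) (v~as (there (here refl)))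
        (joined (there (here refl)) (there (there (there (here refl)))) a≢p)
        (joined (there (there (here refl))) (there (there (there (there (here refl))))) b≢q)
        (All.tabulate λ x∈ _ → x∈) (subst (_≤ length as) (+-comm 4 k) le)
    go (Fin.suc _) with Unique.take⁺ 4 u
    ... | u₄@(_ ∷ (a≢b ∷ a≢p ∷ _) ∷ _) =
      T2-copy uas v~as k (a ∷ b ∷ p ∷ []) u₄ (v~as (here refl))
        (joined (there (here refl)) (there (there (here refl))) a≢b)
        (joined (there (here refl)) (there (there (there (here refl)))) a≢p)
        (All.tabulate λ x∈ _ → x∈) (subst (_≤ length as) (cong suc (+-comm 3 k)) le)

  -- The root is `v`. Since `w` is not a neighbour of `v`, using it as an end of the tree costs no
  -- neighbour, and `m − 2` neighbours suffice for the remaining vertices.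
  distance2⇒tree : ∀ i k {u v w} → (∀ x → 3 + k ≤ length (nbrs G x)) →
    v ~ u → u ~ w → w ≢ v → ¬ v ~ w → Contains G (Tmi i (5 + k))
  distance2⇒tree i k {u} {v} {w} deg vu uw w≢v v≁w = go i
    where
    as = nbrs G v
    uas = nbrs-unique G v
    v~as : ∀ {x} → x ∈ as → v ~ x
    v~as = ∈-nbrs⁻
    at-least-3 : ∀ x → 3 ≤ length (nbrs G x)
    at-least-3 x = ≤-trans (m≤m+n 3 k) (deg x)
    w∉ : ∀ {fs} → w ∈ as → w ∈ fs
    w∉ w∈ = contradiction (v~as w∈) v≁w
    ≢w : ∀ {x} → v ~ x → x ≢ w
    ≢w vx refl = v≁w vx
    outside : ∀ {b q} → v ~ b → b ≢ u → b ~ q → q ≢ v → q ≢ w → q ≢ u → Contains G (T1 (5 + k))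
    outside {b} {q} vb b≢u bq q≢v q≢w q≢u = T1-copy uas v~as k (u ∷ b ∷ q ∷ [])
      ((~⇒≢ vu ∷ ~⇒≢ vb ∷ w≢v ∘ ≡-sym ∷ q≢v ∘ ≡-sym ∷ [])
        ∷ (b≢u ∘ ≡-sym ∷ ~⇒≢ uw ∷ q≢u ∘ ≡-sym ∷ [])
        ∷ (≢w vb ∷ ~⇒≢ bq ∷ []) ∷ (q≢w ∘ ≡-sym ∷ []) ∷ [] ∷ [])
      vu vb uw bq
      ((λ _ → here refl) ∷ (λ _ → there (here refl)) ∷ w∉ ∷ (λ _ → there (there (here refl))) ∷ [])
      (subst (_≤ length as) (+-comm 3 k) (deg v))
    go : ∀ i → Contains G (Tmi i (5 + k))
    -- Besides the leg v-u-w a second disjoint leg is wanted. It is sought through `b` and through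
    -- `b′`; each attempt can fail in one way only, namely `q = w` or `q′ = u`.
    go Fin.zero with pick₂ _≟_ uas (u ∷ []) (at-least-3 v)
    ... | b , b′ , b≢b′ , (b∈ , b∉) , (b′∈ , b′∉)
      with pick₁ _≟_ (nbrs-unique G b) (v ∷ u ∷ []) (at-least-3 b)
         | pick₁ _≟_ (nbrs-unique G b′) (v ∷ w ∷ []) (at-least-3 b′)
    ... | q , q∈ , q∉ | q′ , q′∈ , q′∉ with q ≟ w | q′ ≟ u
    ... | no q≢w | _ = outside (v~as b∈) (b∉ ∘ here) (∈-nbrs⁻ q∈) (q∉ ∘ here) q≢w (q∉ ∘ there ∘ here)
    ... | _ | no q′≢u =
      outside (v~as b′∈) (b′∉ ∘ here) (∈-nbrs⁻ q′∈) (q′∉ ∘ here) (q′∉ ∘ there ∘ here) q′≢u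
    -- Both attempts failed, so `b ~ w` and `b′ ~ u`: the legs v-b-w and v-u-b′ replace the earlier
    -- ones.
    ... | yes refl | yes refl = T1-copy uas v~as k (b ∷ u ∷ b′ ∷ [])
      ((~⇒≢ vb ∷ ~⇒≢ vu ∷ w≢v ∘ ≡-sym ∷ ~⇒≢ vb′ ∷ [])
        ∷ (b∉ ∘ here ∷ ≢w vb ∷ b≢b′ ∷ [])
        ∷ (~⇒≢ uw ∷ b′∉ ∘ here ∘ ≡-sym ∷ []) ∷ (≢w vb′ ∘ ≡-sym ∷ []) ∷ [] ∷ [])
      vb vu (∈-nbrs⁻ q∈) (~-sym (∈-nbrs⁻ q′∈))
      ((λ _ → here refl) ∷ (λ _ → there (here refl)) ∷ w∉ ∷ (λ _ → there (there (here refl))) ∷ [])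
      (subst (_≤ length as) (+-comm 3 k) (deg v))
      where
      vb = v~as b∈
      vb′ = v~as b′∈
    go (Fin.suc _) with pick₁ _≟_ (nbrs-unique G u) (v ∷ w ∷ []) (at-least-3 u)
    ... | q , q∈ , q∉ = T2-copy uas v~as k (u ∷ q ∷ [])
      ((~⇒≢ vu ∷ w≢v ∘ ≡-sym ∷ q∉ ∘ here ∘ ≡-sym ∷ [])
        ∷ (~⇒≢ uw ∷ ~⇒≢ (∈-nbrs⁻ q∈) ∷ []) ∷ (q∉ ∘ there ∘ here ∘ ≡-sym ∷ []) ∷ [] ∷ [])
      vu uw (∈-nbrs⁻ q∈)
      ((λ _ → here refl) ∷ w∉ ∷ (λ _ → there (here refl)) ∷ [])
      (subst (_≤ length as) (cong suc (+-comm 2 k)) (deg v))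

  -- Both ends of the tree are taken in `cs`, outside the neighbourhood of `v`, so `m − 3`
  -- neighbours are enough. Every vertex of `as` misses at most one vertex of `cs`: for `T1`, `a`
  -- sees two of them, `b` sees one of these two, and `a` takes the other.
  bipartite⇒tree : ∀ i k {v as cs} → Unique as → (∀ {x} → x ∈ as → v ~ x) → 2 + k ≤ length as →
    Unique cs → 3 ≤ length cs → (∀ {y} → y ∈ cs → y ≢ v × ¬ v ~ y) →
    (∀ {x y z} → x ∈ as → y ∈ cs → z ∈ cs → y ≢ z → x ~ y ⊎ x ~ z) → Contains G (Tmi i (5 + k))
  bipartite⇒tree i k {v} {as} {cs} uas v~as le ucs le₃ far near = go i
    where
    two : ∀ {x} → x ∈ as → ∃[ y ] ∃[ z ] y ≢ z × (y ∈ cs × x ~ y) × (z ∈ cs × x ~ z)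
    two x∈ with pick₃ _≟_ ucs [] le₃
    ... | a , b , c , (a≢b , a≢c , b≢c) , (a∈ , _) , (b∈ , _) , (c∈ , _)
      with near x∈ a∈ b∈ a≢b | near x∈ b∈ c∈ b≢c | near x∈ a∈ c∈ a≢c
    ... | inj₁ xa | inj₁ xb | _ = a , b , a≢b , (a∈ , xa) , (b∈ , xb)
    ... | inj₁ xa | inj₂ xc | _ = a , c , a≢c , (a∈ , xa) , (c∈ , xc)
    ... | inj₂ xb | _ | inj₁ xa = a , b , a≢b , (a∈ , xa) , (b∈ , xb)
    ... | inj₂ xb | _ | inj₂ xc = b , c , b≢c , (b∈ , xb) , (c∈ , xc)
    v≢ : ∀ {y} → y ∈ cs → v ≢ y
    v≢ y∈ = proj₁ (far y∈) ∘ ≡-sym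
    ∉as : ∀ {y fs} → y ∈ cs → y ∈ as → y ∈ fs
    ∉as y∈ y∈as = contradiction (v~as y∈as) (proj₂ (far y∈))
    as≢cs : ∀ {x y} → x ∈ as → y ∈ cs → x ≢ y
    as≢cs x∈ y∈ refl = proj₂ (far y∈) (v~as x∈)
    T1-from : ∀ {a b p q} → a ∈ as → b ∈ as → p ∈ cs → q ∈ cs → a ≢ b → p ≢ q → a ~ p → b ~ q →
      Contains G (T1 (5 + k))
    T1-from {a} {b} a∈ b∈ p∈ q∈ a≢b p≢q ap bq = T1-copy uas v~as k (a ∷ b ∷ [])
      ((~⇒≢ (v~as a∈) ∷ ~⇒≢ (v~as b∈) ∷ v≢ p∈ ∷ v≢ q∈ ∷ [])
        ∷ (a≢b ∷ as≢cs a∈ p∈ ∷ as≢cs a∈ q∈ ∷ [])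
        ∷ (as≢cs b∈ p∈ ∷ as≢cs b∈ q∈ ∷ []) ∷ (p≢q ∷ []) ∷ [] ∷ [])
      (v~as a∈) (v~as b∈) ap bq
      ((λ _ → here refl) ∷ (λ _ → there (here refl)) ∷ ∉as p∈ ∷ ∉as q∈ ∷ [])
      (subst (_≤ length as) (+-comm 2 k) le)
    go : ∀ i → Contains G (Tmi i (5 + k))
    go i with pick₂ _≟_ uas [] (≤-trans (m≤m+n 2 k) le)
    ... | a , b , a≢b , (a∈ , _) , (b∈ , _) with two a∈
    go Fin.zero | a , b , a≢b , (a∈ , _) , (b∈ , _) | y , z , y≢z , (y∈ , ay) , (z∈ , az)
      with near b∈ y∈ z∈ y≢z
    ... | inj₁ by = T1-from a∈ b∈ z∈ y∈ a≢b (y≢z ∘ ≡-sym) az by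
    ... | inj₂ bz = T1-from a∈ b∈ y∈ z∈ a≢b y≢z ay bz
    go (Fin.suc _) | a , b , a≢b , (a∈ , _) , (b∈ , _) | y , z , y≢z , (y∈ , ay) , (z∈ , az) =
      T2-copy uas v~as k (a ∷ [])
        ((~⇒≢ (v~as a∈) ∷ v≢ y∈ ∷ v≢ z∈ ∷ []) ∷ (as≢cs a∈ y∈ ∷ as≢cs a∈ z∈ ∷ [])
          ∷ (y≢z ∷ []) ∷ [] ∷ [])
        (v~as a∈) ay az ((λ _ → here refl) ∷ ∉as y∈ ∷ ∉as z∈ ∷ [])
        (subst (_≤ length as) (cong suc (+-comm 1 k)) le)

  -- The hypothesis `near` says that the complement is a matching on `as`, so two of any three
  -- vertices there include a suitable edge at `a`. With root `z`, the non-neighbour `z′` serves as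
  -- one end: the legs are z-c-z′ and z-a-b for `T1`, and `a` carries `z′` and `b` for `T2`.
  cocktailParty⇒tree : ∀ i k {z z′ as} → Unique as → 3 + k ≤ length as →
    (∀ {x} → x ∈ as → z ~ x) → (∀ {x} → x ∈ as → x ~ z′) → z′ ≢ z → ¬ z ~ z′ →
    (∀ {x y w} → x ∈ as → y ∈ as → w ∈ as → y ≢ x → w ≢ x → y ≢ w → x ~ y ⊎ x ~ w) →
    Contains G (Tmi i (5 + k))
  cocktailParty⇒tree i k {z} {z′} {as} uas le z~as as~z′ z′≢z z≁z′ near
    with pick₃ _≟_ uas [] (≤-trans (m≤m+n 3 k) le)
  ... | a , b , c , (a≢b , a≢c , b≢c) , (a∈ , _) , (b∈ , _) , (c∈ , _) =
    [ go i a∈ b∈ c∈ a≢b a≢c b≢c , go i a∈ c∈ b∈ a≢c a≢b (b≢c ∘ ≡-sym) ]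
      (near a∈ b∈ c∈ (a≢b ∘ ≡-sym) (a≢c ∘ ≡-sym) b≢c)
    where
    z′∉ : ∀ {fs} → z′ ∈ as → z′ ∈ fs
    z′∉ z′∈ = contradiction (z~as z′∈) z≁z′
    go : ∀ i {a b c} → a ∈ as → b ∈ as → c ∈ as → a ≢ b → a ≢ c → b ≢ c → a ~ b →
      Contains G (Tmi i (5 + k))
    go Fin.zero {a} {b} {c} a∈ b∈ c∈ a≢b a≢c b≢c ab = T1-copy uas z~as k (c ∷ a ∷ b ∷ [])
      ((~⇒≢ (z~as c∈) ∷ ~⇒≢ (z~as a∈) ∷ z′≢z ∘ ≡-sym ∷ ~⇒≢ (z~as b∈) ∷ [])
        ∷ (a≢c ∘ ≡-sym ∷ ~⇒≢ (as~z′ c∈) ∷ b≢c ∘ ≡-sym ∷ [])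
        ∷ (~⇒≢ (as~z′ a∈) ∷ a≢b ∷ []) ∷ (~⇒≢ (as~z′ b∈) ∘ ≡-sym ∷ []) ∷ [] ∷ [])
      (z~as c∈) (z~as a∈) (as~z′ c∈) ab
      ((λ _ → here refl) ∷ (λ _ → there (here refl)) ∷ z′∉ ∷ (λ _ → there (there (here refl))) ∷ [])
      (subst (_≤ length as) (+-comm 3 k) le)
    go (Fin.suc _) {a} {b} {c} a∈ b∈ c∈ a≢b a≢c b≢c ab = T2-copy uas z~as k (a ∷ b ∷ [])
      ((~⇒≢ (z~as a∈) ∷ z′≢z ∘ ≡-sym ∷ ~⇒≢ (z~as b∈) ∷ [])
        ∷ (~⇒≢ (as~z′ a∈) ∷ a≢b ∷ []) ∷ (~⇒≢ (as~z′ b∈) ∘ ≡-sym ∷ []) ∷ [] ∷ [])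
      (z~as a∈) (as~z′ a∈) ab
      ((λ _ → here refl) ∷ z′∉ ∷ (λ _ → there (here refl)) ∷ [])
      (subst (_≤ length as) (cong suc (+-comm 2 k)) le)

-- Upper bounds

module Complement {N} (G : Graph N) where
  open Embed G
  open Embed (complement G) public using () renaming
    (_~_ to infix 4 _≁_; ~-sym to ≁-sym; ~⇒≢ to ≁⇒≢; T'-copy to T'-copyᶜ; T*-copy to T*-copyᶜ)

  ≁⁺ : ∀ {u v} → u ≢ v → ¬ u ~ v → u ≁ v
  ≁⁺ {u} {v} u≢v ¬e with u ≟ v
  ... | yes u≡v = contradiction u≡v u≢v
  ... | no _ = cong not (¬-not ¬e)

  ≁⇒¬~ : ∀ {u v} → u ≁ v → ¬ u ~ v
  ≁⇒¬~ {u} {v} e e′ with u ≟ v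
  ≁⇒¬~ () _ | yes _
  ... | no _ rewrite e′ = contradiction e λ ()

  ¬≁⇒~ : ∀ {u v} → u ≢ v → ¬ u ≁ v → u ~ v
  ¬≁⇒~ {u} {v} u≢v ¬e with adj G u v Bool.≟ true
  ... | yes e = e
  ... | no ¬e′ = contradiction (≁⁺ u≢v ¬e′) ¬e

  degree-sum : ∀ v → N ≤ suc (length (nbrs G v) + length (nbrs (complement G) v))
  degree-sum v = subst₂ _≤_ (length-tabulate {n = N} id) (cong suc (length-++ (nbrs G v)))
    (⊆-length (Unique.allFin⁺ N) covered)
    where
    covered : ∀ {u} → u ∈ allFin N → u ∈ v ∷ nbrs G v ++ nbrs (complement G) v
    covered {u} _ with u ≟ v | adj G v u Bool.≟ true
    ... | yes u≡v | _ = here u≡v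
    ... | no _ | yes e = there (∈-++⁺ˡ (∈-nbrs⁺ G e))
    ... | no u≢v | no ¬e =
      there (∈-++⁺ʳ (nbrs G v) (∈-nbrs⁺ (complement G) (≁⁺ (u≢v ∘ ≡-sym) ¬e)))

module _ {N} (G : Graph N) where
  open Embed G
  open Complement G

  small-degree : ∀ i k → ¬ (4 + k ∣ N) →
    Contains G (Tmi i (5 + k)) ⊎ (∃[ v ] length (nbrs G v) ≤ 2 + k)
  small-degree i k ∤N with any? (λ v → length (nbrs G v) ≤? 2 + k)
  ... | yes small = inj₂ small
  ... | no large = inj₁ found
    where
    deg : ∀ v → 3 + k ≤ length (nbrs G v)
    deg v = ≰⇒> (λ le → large (v , le))
    _≈_ : Fin N → Fin N → Set
    u ≈ v = u ≡ v ⊎ u ~ v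
    _≈?_ : ∀ u v → Dec (u ≈ v)
    u ≈? v = (u ≟ v) ⊎-dec (adj G u v Bool.≟ true)
    ≈-sym : ∀ {u v} → u ≈ v → v ≈ u
    ≈-sym (inj₁ eq) = inj₁ (≡-sym eq)
    ≈-sym (inj₂ e) = inj₂ (~-sym e)
    class : Fin N → List (Fin N)
    class v = filter (v ≈?_) (allFin N)
    class-unique : ∀ v → Unique (class v)
    class-unique v = Unique.filter⁺ (v ≈?_) (Unique.allFin⁺ N)
    class-large : ∀ v → 4 + k ≤ length (class v)
    class-large v = ≤-trans (s≤s (deg v)) (⊆-length
      (All.tabulate (λ u∈ → ~⇒≢ (∈-nbrs⁻ G u∈)) ∷ nbrs-unique G v) λ where
        (here refl) → ∈-filter⁺ (v ≈?_) (∈-allFin v) (inj₁ refl)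
        (there u∈) → ∈-filter⁺ (v ≈?_) (∈-allFin _) (inj₂ (∈-nbrs⁻ G u∈)))
    found : Contains G (Tmi i (5 + k))
    found with any? (λ v → any? λ u → any? λ w →
      (adj G v u Bool.≟ true) ×-dec (adj G u w Bool.≟ true) ×-dec ¬? (w ≟ v)
        ×-dec ¬? (adj G v w Bool.≟ true))
    ... | yes (v , u , w , vu , uw , w≢v , v≁w) = distance2⇒tree G i k deg vu uw w≢v v≁w
    ... | no no-distance-2 = from-classes
      where
      -- Without two vertices at distance 2, equality-or-adjacency is an equivalence, and its
      -- classes are cliques.
      ≈-trans : ∀ {u v w} → u ≈ v → v ≈ w → u ≈ w
      ≈-trans (inj₁ refl) e = e
      ≈-trans e (inj₁ refl) = e
      ≈-trans {u} {v} {w} (inj₂ uv) (inj₂ vw) with u ≈? w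
      ... | yes e = e
      ... | no ¬e = contradiction
        (u , v , w , uv , vw , ¬e ∘ inj₁ ∘ ≡-sym , ¬e ∘ inj₂) no-distance-2
      from-classes : Contains G (Tmi i (5 + k))
      from-classes with any? (λ v → 5 + k ≤? length (class v))
      ... | yes (v , big) = clique⇒tree G i k (class v) (class-unique v) joined big
        where
        joined : ∀ {x y} → x ∈ class v → y ∈ class v → x ≢ y → x ~ y
        joined x∈ y∈ x≢y with ≈-trans (≈-sym (proj₂ (∈-filter⁻ (v ≈?_) {xs = allFin N} x∈)))
                                      (proj₂ (∈-filter⁻ (v ≈?_) {xs = allFin N} y∈))
        ... | inj₁ eq = contradiction eq x≢y
        ... | inj₂ e = e
      -- The degree condition and the absence of larger classes pin every class to order `m − 1`,
      -- which would then divide `N`.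
      ... | no ¬big = contradiction (subst (4 + k ∣_) (length-tabulate {n = N} id)
        (classSize∣length _≈?_ (inj₁ refl) ≈-sym ≈-trans (4 + k) (allFin N)
          λ {v} _ → ≤-antisym (≤-pred (≰⇒> (λ le → ¬big (v , le)))) (class-large v))) ∤N

module _ {N} (G : Graph N) (i : Fin 2) (k j : ℕ) where
  open Embed G
  open Complement G

  private
    far : Fin N → List (Fin N)
    far = nbrs (complement G)

    far-large : ∀ {v s} → N ≡ suc (2 + k + s) → length (nbrs G v) ≤ 2 + k → s ≤ length (far v)
    far-large {v} refl small =
      +-cancelˡ-≤ (2 + k) _ _ (≤-trans (≤-pred (degree-sum v)) (+-monoˡ-≤ _ small))

    near-large : ∀ {v s} → N ≡ suc (2 + k + s) → length (far v) ≤ s → 2 + k ≤ length (nbrs G v)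
    near-large {v} {s} refl small =
      +-cancelʳ-≤ s _ _ (≤-trans (≤-pred (degree-sum v)) (+-monoʳ-≤ (length (nbrs G v)) small))

    v∉far : ∀ {v x} → x ∈ far v → x ≢ v × ¬ v ~ x
    v∉far x∈ = ≁⇒≢ (∈-nbrs⁻ (complement G) x∈) ∘ ≡-sym , ≁⇒¬~ (∈-nbrs⁻ (complement G) x∈)

    far⁻ : ∀ {v x} → x ∈ far v → v ≁ x
    far⁻ = ∈-nbrs⁻ (complement G)

    far⁺ : ∀ {v x} → v ≁ x → x ∈ far v
    far⁺ = ∈-nbrs⁺ (complement G)

    _≁?_ : ∀ u v → Dec (u ≁ v)
    u ≁? v = adj (complement G) u v Bool.≟ true

  -- Here `n = 3 + j` and `N = m + n − 4`. If `v` has at least `n − 1` non-neighbours, a complement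
  -- edge from one of them to any vertex but `v` completes `T'`; if there is none, they form a
  -- clique. If it has exactly `n − 2`, the edge has to end in a neighbour of `v`; if there is none,
  -- `G` is complete between the two sides.
  T'-upper : N ≡ 4 + k + j → 3 + k ≤ j → ¬ (4 + k ∣ N) →
    Contains G (Tmi i (5 + k)) ⊎ Contains (complement G) (T' (3 + j))
  T'-upper N≡ k≤j ∤N with small-degree G i k ∤N
  ... | inj₁ c = inj₁ c
  ... | inj₂ (v , small) with 2 + j ≤? length (far v)
  ... | yes big = search
    where
    u = nbrs-unique (complement G) v
    search : _
    search with any? (λ a → any? λ x → (v ≁? a) ×-dec (a ≁? x) ×-dec ¬? (x ≟ v))
    ... | yes (a , x , va , ax , x≢v) = inj₂ (T'-copyᶜ u far⁻ j (a ∷ x ∷ [])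
      ((≁⇒≢ va ∷ x≢v ∘ ≡-sym ∷ []) ∷ (≁⇒≢ ax ∷ []) ∷ [] ∷ []) va ax
      (All.tabulate λ x∈ _ → x∈) (subst (_≤ length (far v)) (+-comm 2 j) big))
    ... | no none = inj₁ (clique⇒tree G i k (far v) u
      (λ {x} {y} x∈ y∈ x≢y → ¬≁⇒~ x≢y λ xy → none (x , y , far⁻ x∈ , xy , proj₁ (v∉far y∈)))
      (≤-trans (s≤s (s≤s k≤j)) big))
  ... | no ¬big = search
    where
    u = nbrs-unique (complement G) v
    N≡′ : N ≡ suc (2 + k + suc j)
    N≡′ = trans N≡ (cong (3 +_) (≡-sym (+-suc k j)))
    search : _
    search with any? (λ a → any? λ x → (v ≁? a) ×-dec (a ≁? x) ×-dec (adj G v x Bool.≟ true))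
    ... | yes (a , x , va , ax , vx) = inj₂ (T'-copyᶜ u far⁻ j (a ∷ [])
      ((≁⇒≢ va ∷ ~⇒≢ vx ∷ []) ∷ (≁⇒≢ ax ∷ []) ∷ [] ∷ []) va ax
      ((λ x∈ → here refl) ∷ (λ x∈ → contradiction vx (≁⇒¬~ (far⁻ x∈))) ∷ [])
      (subst (_≤ length (far v)) (+-comm 1 j) (far-large N≡′ small)))
    ... | no none = inj₁ (bipartite⇒tree G i k (nbrs-unique G v) (∈-nbrs⁻ G)
      (near-large N≡′ (≤-pred (≰⇒> ¬big))) u
      (≤-trans (s≤s (≤-trans (m≤m+n 2 (suc k)) k≤j)) (far-large N≡′ small)) v∉far
      λ {x} {y} x∈ y∈ _ _ → inj₁ (¬≁⇒~
        (λ where refl → ≁⇒¬~ (far⁻ y∈) (∈-nbrs⁻ G x∈))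
        (λ xy → none (y , x , far⁻ y∈ , ≁-sym xy , ∈-nbrs⁻ G x∈))))

  -- Here `n = 4 + j`. The case distinction is that of `T'-upper`, with a complement path v-a-x-y in
  -- place of a single edge; its absence leaves a few complement edges, which the matching-tolerant
  -- configurations absorb.
  T*-upper : N ≡ 5 + k + j → 2 + k ≤ j → ¬ (4 + k ∣ N) →
    Contains G (Tmi i (5 + k)) ⊎ Contains (complement G) (T* (4 + j))
  T*-upper N≡ k≤j ∤N with small-degree G i k ∤N
  ... | inj₁ c = inj₁ c
  ... | inj₂ (v , small) with 3 + j ≤? length (far v)
  ... | yes big = search
    where
    u = nbrs-unique (complement G) v
    search : _
    search with any? (λ a → any? λ x → any? λ y →
      (v ≁? a) ×-dec (a ≁? x) ×-dec (x ≁? y) ×-dec ¬? (x ≟ v) ×-dec ¬? (y ≟ v) ×-dec ¬? (y ≟ a))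
    ... | yes (a , x , y , va , ax , xy , x≢v , y≢v , y≢a) = inj₂ (T*-copyᶜ u far⁻ j (a ∷ x ∷ y ∷ [])
      ((≁⇒≢ va ∷ x≢v ∘ ≡-sym ∷ y≢v ∘ ≡-sym ∷ []) ∷ (≁⇒≢ ax ∷ y≢a ∘ ≡-sym ∷ [])
        ∷ (≁⇒≢ xy ∷ []) ∷ [] ∷ [])
      va ax xy (All.tabulate λ x∈ _ → x∈) (subst (_≤ length (far v)) (+-comm 3 j) big))
    ... | no no-path with any? (λ z → any? λ z′ → (v ≁? z) ×-dec (v ≁? z′) ×-dec (z ≁? z′))
    ... | no none = inj₁ (clique⇒tree G i k (far v) u
      (λ {x} {y} x∈ y∈ x≢y → ¬≁⇒~ x≢y λ xy → none (x , y , far⁻ x∈ , far⁻ y∈ , xy))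
      (≤-trans (s≤s (s≤s (s≤s k≤j))) big))
    -- A third vertex nonadjacent to `z` or `z′` would extend the complement edge zz′ to a forbidden
    -- path, so both are adjacent to everything chosen here.
    ... | yes (z , z′ , vz , vz′ , zz′)
      with pick _≟_ (3 + k) u (z ∷ z′ ∷ [])
        (≤-trans (≤-reflexive (+-comm (3 + k) 2)) (≤-trans (s≤s (s≤s (s≤s k≤j))) big))
    ... | as , len , uas , spec = inj₁ (cocktailParty⇒tree G i k uas (≤-reflexive (≡-sym len))
      (λ {x} x∈ → ¬≁⇒~ (proj₂ (spec x∈) ∘ here ∘ ≡-sym)
        λ zx → avoid-path vz′ (≁-sym zz′) zx (proj₁ (v∉far (far⁺ vz))) (≢v x∈)
          (proj₂ (spec x∈) ∘ there ∘ here))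
      (λ {x} x∈ → ¬≁⇒~ (proj₂ (spec x∈) ∘ there ∘ here)
        λ xz′ → avoid-path vz zz′ (≁-sym xz′) (proj₁ (v∉far (far⁺ vz′))) (≢v x∈)
          (proj₂ (spec x∈) ∘ here))
      (≁⇒≢ zz′ ∘ ≡-sym) (≁⇒¬~ zz′) near)
      where
      ≢v : ∀ {x} → x ∈ as → x ≢ v
      ≢v x∈ = proj₁ (v∉far (proj₁ (spec x∈)))
      avoid-path : ∀ {a x y} → v ≁ a → a ≁ x → x ≁ y → x ≢ v → y ≢ v → y ≢ a → ⊥
      avoid-path va ax xy x≢v y≢v y≢a = no-path (_ , _ , _ , va , ax , xy , x≢v , y≢v , y≢a)
      near : ∀ {x y w} → x ∈ as → y ∈ as → w ∈ as → y ≢ x → w ≢ x → y ≢ w → x ~ y ⊎ x ~ w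
      near {x} {y} {w} x∈ y∈ w∈ y≢x w≢x y≢w with adj G x y Bool.≟ true
      ... | yes xy = inj₁ xy
      ... | no ¬xy = inj₂ (¬≁⇒~ (w≢x ∘ ≡-sym) λ xw → avoid-path (far⁻ (proj₁ (spec y∈)))
        (≁-sym (≁⁺ (y≢x ∘ ≡-sym) ¬xy)) xw (≢v x∈) (≢v w∈) (y≢w ∘ ≡-sym))
  ... | no ¬big = search
    where
    u = nbrs-unique (complement G) v
    N≡′ : N ≡ suc (2 + k + (2 + j))
    N≡′ = trans N≡ (cong (3 +_) (≡-sym (trans (+-suc k (suc j)) (cong suc (+-suc k j)))))
    search : _
    search with any? (λ a → any? λ x → any? λ y →
      (v ≁? a) ×-dec (a ≁? x) ×-dec (x ≁? y) ×-dec (adj G v x Bool.≟ true) ×-dec ¬? (y ≟ a))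
    ... | yes (a , x , y , va , ax , xy , vx , y≢a) = inj₂ (T*-copyᶜ u far⁻ j (a ∷ y ∷ [])
      ((≁⇒≢ va ∷ ~⇒≢ vx ∷ v≢y ∷ []) ∷ (≁⇒≢ ax ∷ y≢a ∘ ≡-sym ∷ []) ∷ (≁⇒≢ xy ∷ []) ∷ [] ∷ []) va ax xy
      ((λ _ → here refl) ∷ (λ x∈ → contradiction vx (≁⇒¬~ (far⁻ x∈))) ∷ (λ _ → there (here refl)) ∷ [])
      (subst (_≤ length (far v)) (+-comm 2 j) (far-large N≡′ small)))
      where
      v≢y : v ≢ y
      v≢y refl = ≁⇒¬~ xy (~-sym vx)
    -- Two non-edges from a neighbour `x` of `v` to `far v` would give the path v-y-x-z in the
    -- complement, so `x` misses at most one vertex there.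
    ... | no none = inj₁ (bipartite⇒tree G i k (nbrs-unique G v) (∈-nbrs⁻ G)
      (near-large N≡′ (≤-pred (≰⇒> ¬big))) u
      (≤-trans (s≤s (s≤s (≤-trans (s≤s z≤n) k≤j))) (far-large N≡′ small)) v∉far near)
      where
      near : ∀ {x y z} → x ∈ nbrs G v → y ∈ far v → z ∈ far v → y ≢ z → x ~ y ⊎ x ~ z
      near {x} {y} {z} x∈ y∈ z∈ y≢z with adj G x y Bool.≟ true
      ... | yes xy = inj₁ xy
      ... | no ¬xy = inj₂ (¬≁⇒~ (apart z∈) λ xz →
        none (y , x , z , far⁻ y∈ , ≁-sym (≁⁺ (apart y∈) ¬xy) , xz , ∈-nbrs⁻ G x∈ , y≢z ∘ ≡-sym))
        where
        apart : ∀ {y} → y ∈ far v → x ≢ y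
        apart y∈ refl = ≁⇒¬~ (far⁻ y∈) (∈-nbrs⁻ G x∈)

-- A 1-factorisation of the complete graph

%-≡⇒∣∸ : ∀ r {a b} → a ≤ b → a % suc r ≡ b % suc r → suc r ∣ b ∸ a
%-≡⇒∣∸ r {a} {b} a≤b eq = ∣m+n∣m⇒∣n (subst (suc r ∣_) quotients (n∣m*n (b / suc r))) (n∣m*n (a / suc r))
  where
  open ≡-Reasoning
  quotients : b / suc r * suc r ≡ a / suc r * suc r + (b ∸ a)
  quotients = +-cancelˡ-≡ (a % suc r) _ _ (begin
    a % suc r + b / suc r * suc r             ≡⟨ cong (_+ b / suc r * suc r) eq ⟩
    b % suc r + b / suc r * suc r             ≡⟨ m≡m%n+[m/n]*n b (suc r) ⟨
    b                                         ≡⟨ m+[n∸m]≡n a≤b ⟨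
    a + (b ∸ a)                               ≡⟨ cong (_+ (b ∸ a)) (m≡m%n+[m/n]*n a (suc r)) ⟩
    a % suc r + a / suc r * suc r + (b ∸ a)   ≡⟨ +-assoc (a % suc r) _ _ ⟩
    a % suc r + (a / suc r * suc r + (b ∸ a)) ∎)

∣∸⇒≡ : ∀ {r a b} → a ≤ b → b < suc r → suc r ∣ b ∸ a → a ≡ b
∣∸⇒≡ {r} {a} {b} a≤b b<r r∣ with b ∸ a in eq
... | zero = ≤-antisym a≤b (m∸n≡0⇒m≤n eq)
... | suc x = contradiction r∣
  (>⇒∤ (<-≤-trans (s≤s (≤-trans (≤-reflexive (≡-sym eq)) (m∸n≤m b a))) b<r))

%-cancelˡ-+ : ∀ r i {a b} → a < suc r → b < suc r → (i + a) % suc r ≡ (i + b) % suc r → a ≡ b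
%-cancelˡ-+ r i {a} {b} a< b< eq with ≤-total a b
... | inj₁ a≤b = ∣∸⇒≡ a≤b b<
  (subst (suc r ∣_) ([m+n]∸[m+o]≡n∸o i b a) (%-≡⇒∣∸ r (+-monoʳ-≤ i a≤b) eq))
... | inj₂ b≤a = ≡-sym (∣∸⇒≡ b≤a a<
  (subst (suc r ∣_) ([m+n]∸[m+o]≡n∸o i a b) (%-≡⇒∣∸ r (+-monoʳ-≤ i b≤a) (≡-sym eq))))

-- The number `suc t` inverts 2 modulo `suc (t + t)`: multiplying `x + x` by it gives `x` plus a
-- multiple of the modulus.
odd∣double : ∀ t x → suc (t + t) ∣ x + x → suc (t + t) ∣ x
odd∣double t x r∣ = ∣m+n∣m⇒∣n (subst (suc (t + t) ∣_) (identity t x) (∣n⇒∣m*n (suc t) r∣)) (n∣m*n x)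
  where
  identity : ∀ t x → suc t * (x + x) ≡ x * suc (t + t) + x
  identity = solve-∀

%-cancel-double : ∀ t {a b} → a < suc (t + t) → b < suc (t + t) →
  (a + a) % suc (t + t) ≡ (b + b) % suc (t + t) → a ≡ b
%-cancel-double t {a} {b} a< b< eq =
  [ (λ a≤b → half a≤b b< eq) , (λ b≤a → ≡-sym (half b≤a a< (≡-sym eq))) ] (≤-total a b)
  where
  half : ∀ {a b} → a ≤ b → b < suc (t + t) → (a + a) % suc (t + t) ≡ (b + b) % suc (t + t) → a ≡ b
  half {a} {b} a≤b b< eq = ∣∸⇒≡ a≤b b< (odd∣double t (b ∸ a)
    (subst (suc (t + t) ∣_) double-∸ (%-≡⇒∣∸ (t + t) (+-mono-≤ a≤b a≤b) eq)))
    where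
    double-∸ : (b + b) ∸ (a + a) ≡ (b ∸ a) + (b ∸ a)
    double-∸ = begin
      (b + b) ∸ (a + a)                       ≡⟨ cong (λ c → (c + c) ∸ (a + a)) (m+[n∸m]≡n a≤b) ⟨
      (a + x + (a + x)) ∸ (a + a)             ≡⟨ cong (_∸ (a + a)) (regroup a x) ⟩
      (a + a + (x + x)) ∸ (a + a)             ≡⟨ m+n∸m≡n (a + a) (x + x) ⟩
      x + x                                   ∎
      where
      open ≡-Reasoning
      x = b ∸ a
      regroup : ∀ a x → a + x + (a + x) ≡ a + a + (x + x)
      regroup = solve-∀

-- The round-robin 1-factorisation of the complete graph on {0, …, r} with r odd: the edge ij
-- gets colour i + j mod r, except that the vertex r stands for ∞ and the edge i∞ gets 2i mod r.
module RoundRobin (t : ℕ) where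
  r = suc (t + t)

  colourSum : ℕ → ℕ → ℕ
  colourSum i j with i ℕ.≟ r | j ℕ.≟ r
  ... | yes _ | _ = j + j
  ... | no _ | yes _ = i + i
  ... | no _ | no _ = i + j

  colour : ℕ → ℕ → ℕ
  colour i j = colourSum i j % r

  colour-sym : ∀ i j → colour i j ≡ colour j i
  colour-sym i j with i ℕ.≟ r | j ℕ.≟ r
  ... | yes refl | yes refl = refl
  ... | yes _ | no _ = refl
  ... | no _ | yes _ = refl
  ... | no _ | no _ = cong (_% r) (+-comm i j)

  -- Properness of the colouring. At ∞ it is injectivity of doubling modulo an odd number; at a
  -- finite `i` it is cancellation of `i`, where the value `i + i`, never taken by a finite
  -- neighbour, is left to the edge to ∞.
  colour-injective : ∀ {i a b} → i ≤ r → a ≤ r → b ≤ r → a ≢ i → b ≢ i →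
    colour i a ≡ colour i b → a ≡ b
  colour-injective {i} {a} {b} i≤ a≤ b≤ a≢i b≢i eq with i ℕ.≟ r | a ℕ.≟ r | b ℕ.≟ r
  ... | yes refl | _ | _ = %-cancel-double t (≤∧≢⇒< a≤ a≢i) (≤∧≢⇒< b≤ b≢i) eq
  ... | no _ | yes refl | yes refl = refl
  ... | no i≢ | yes refl | no b≢ =
    contradiction (≡-sym (%-cancelˡ-+ (t + t) i (≤∧≢⇒< i≤ i≢) (≤∧≢⇒< b≤ b≢) eq)) b≢i
  ... | no i≢ | no a≢ | yes refl =
    contradiction (%-cancelˡ-+ (t + t) i (≤∧≢⇒< a≤ a≢) (≤∧≢⇒< i≤ i≢) eq) a≢i
  ... | no _ | no a≢ | no b≢ = %-cancelˡ-+ (t + t) i (≤∧≢⇒< a≤ a≢) (≤∧≢⇒< b≤ b≢) eq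

-- Lower bounds

edgeless : ∀ N → Graph N
edgeless N = record { adj = λ _ _ → false ; sym = λ _ _ → refl ; irref = λ _ → refl }

complete : ∀ N → Graph N
complete N = complement (edgeless N)

-- Disjoint unions and connectedness of the trees

data Side a b : Fin (a + b) → Set where
  left  : ∀ x → Side a b (x ↑ˡ b)
  right : ∀ y → Side a b (a ↑ʳ y)

side : ∀ a b v → Side a b v
side a b v with splitAt a v in eq
... | inj₁ x = subst (Side a b) (splitAt⁻¹-↑ˡ eq) (left x)
... | inj₂ y = subst (Side a b) (splitAt⁻¹-↑ʳ {m = a} eq) (right y)

module Union {a b} (G₁ : Graph a) (G₂ : Graph b) where
  adj⊎ : Fin a ⊎ Fin b → Fin a ⊎ Fin b → Bool
  adj⊎ (inj₁ x) (inj₁ y) = adj G₁ x y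
  adj⊎ (inj₂ x) (inj₂ y) = adj G₂ x y
  adj⊎ _ _ = false

  union : Graph (a + b)
  union = record
    { adj = λ u v → adj⊎ (splitAt a u) (splitAt a v)
    ; sym = λ u v → adj⊎-sym (splitAt a u) (splitAt a v)
    ; irref = λ v → adj⊎-irref (splitAt a v) }
    where
    adj⊎-sym : ∀ p q → adj⊎ p q ≡ adj⊎ q p
    adj⊎-sym (inj₁ x) (inj₁ y) = Graph.sym G₁ x y
    adj⊎-sym (inj₁ _) (inj₂ _) = refl
    adj⊎-sym (inj₂ _) (inj₁ _) = refl
    adj⊎-sym (inj₂ x) (inj₂ y) = Graph.sym G₂ x y
    adj⊎-irref : ∀ p → adj⊎ p p ≡ false
    adj⊎-irref (inj₁ x) = irref G₁ x
    adj⊎-irref (inj₂ x) = irref G₂ x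

  adj-left : ∀ x y → adj union (x ↑ˡ b) (y ↑ˡ b) ≡ adj G₁ x y
  adj-left x y = cong₂ adj⊎ (splitAt-↑ˡ a x b) (splitAt-↑ˡ a y b)

  adj-right : ∀ x y → adj union (a ↑ʳ x) (a ↑ʳ y) ≡ adj G₂ x y
  adj-right x y = cong₂ adj⊎ (splitAt-↑ʳ a b x) (splitAt-↑ʳ a b y)

  adj-leftright : ∀ x y → adj union (x ↑ˡ b) (a ↑ʳ y) ≡ false
  adj-leftright x y = cong₂ adj⊎ (splitAt-↑ˡ a x b) (splitAt-↑ʳ a b y)

  adj-rightleft : ∀ x y → adj union (a ↑ʳ y) (x ↑ˡ b) ≡ false
  adj-rightleft x y = cong₂ adj⊎ (splitAt-↑ʳ a b y) (splitAt-↑ˡ a x b)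
open Union using (union)

-- Tmi i (5 + k), with a size that reduces even when i is a variable.
tree : Fin 2 → ℕ → Pattern
tree i k = mkPattern (5 + k) (E (Tmi i (5 + k)))

TreeFree : ℕ → ∀ {N} → Graph N → Set
TreeFree k G = ∀ i → ¬ Contains G (tree i k)

Tmi-star : ∀ i k {y} → 1 ≤ y → y ≤ 2 + k → E (Tmi i (5 + k)) 0 y
Tmi-star Fin.zero k p q = inj₁ (refl , p , q)
Tmi-star (Fin.suc _) k p q = inj₁ (refl , p , q)

Tmi-path : ∀ i k {y} → y < 5 + k → y ≡ 0 ⊎ E (Tmi i (5 + k)) 0 y
  ⊎ (∃[ p ] p < 5 + k × E (Tmi i (5 + k)) 0 p × E (Tmi i (5 + k)) p y)
Tmi-path i k {zero} _ = inj₁ refl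
Tmi-path i k {suc y} lt with suc y ≤? 2 + k | suc y ℕ.≟ 3 + k
... | yes le | _ = inj₂ (inj₁ (Tmi-star i k (s≤s z≤n) le))
Tmi-path Fin.zero k {suc y} lt | no _ | yes refl =
  inj₂ (inj₂ (1 + k , +-monoˡ-≤ k (m≤m+n 2 3) ,
    Tmi-star Fin.zero k (s≤s z≤n) (n≤1+n _) , inj₂ (inj₁ (refl , refl))))
Tmi-path (Fin.suc i) k {suc y} lt | no _ | yes refl =
  inj₂ (inj₂ (2 + k , +-monoˡ-≤ k (m≤m+n 3 2) ,
    Tmi-star (Fin.suc i) k (s≤s z≤n) ≤-refl , inj₂ (inj₁ (refl , refl))))
Tmi-path i k {suc y} lt | no ≰ | no ≢3 with ≤-antisym (≤-pred lt) (≤∧≢⇒< (≰⇒> ≰) (≢3 ∘ ≡-sym))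
Tmi-path Fin.zero k lt | no _ | no _ | refl =
  inj₂ (inj₂ (2 + k , +-monoˡ-≤ k (m≤m+n 3 2) ,
    Tmi-star Fin.zero k (s≤s z≤n) ≤-refl , inj₂ (inj₂ (refl , refl))))
Tmi-path (Fin.suc i) k lt | no _ | no _ | refl =
  inj₂ (inj₂ (2 + k , +-monoˡ-≤ k (m≤m+n 3 2) ,
    Tmi-star (Fin.suc i) k (s≤s z≤n) ≤-refl , inj₂ (inj₂ (refl , refl))))

-- Every vertex is within distance 2 of the root. Connectedness is phrased through maps constant
-- along edges so that it applies to the map telling the two sides of a disjoint union apart.
Tmi-connected : ∀ i k {A : Set} (h : Fin (5 + k) → A) →
  (∀ s t → E (Tmi i (5 + k)) (toℕ s) (toℕ t) → h s ≡ h t) → ∀ s → h s ≡ h Fin.zero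
Tmi-connected i k h edge s with Tmi-path i k (toℕ<n s)
... | inj₁ eq = cong h (toℕ-injective eq)
... | inj₂ (inj₁ e) = ≡-sym (edge Fin.zero s e)
... | inj₂ (inj₂ (p , p< , e , e′)) with edge Fin.zero (fromℕ< p<) | edge (fromℕ< p<) s
... | edge₁ | edge₂ rewrite toℕ-fromℕ< p< = ≡-sym (trans (edge₁ e) (edge₂ e′))

corestrict : ∀ {a N} {G : Graph N} {G₁ : Graph a} {H} (ι : Fin a → Fin N) →
  (∀ x y → adj G (ι x) (ι y) ≡ adj G₁ x y) →
  (c : Contains G H) → (∀ s → ∃[ x ] proj₁ c s ≡ ι x) → Contains G₁ H
corestrict {G = G} ι ι-adj (f , f-inj , f-edge) lift = proj₁ ∘ lift ,
  (λ {s} {t} eq → f-inj (trans (proj₂ (lift s)) (trans (cong ι eq) (≡-sym (proj₂ (lift t)))))) ,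
  λ s t e → trans (≡-sym (ι-adj _ _))
    (trans (≡-sym (cong₂ (adj G) (proj₂ (lift s)) (proj₂ (lift t)))) (f-edge s t e))

module _ {a b} {G₁ : Graph a} {G₂ : Graph b} where
  open Union G₁ G₂ hiding (union)

  -- A copy of a connected tree stays on the side of its root and hence is a copy in one of the two
  -- parts.
  union-treeFree : ∀ {k} → TreeFree k G₁ → TreeFree k G₂ → TreeFree k (union G₁ G₂)
  union-treeFree {k} free₁ free₂ i c@(f , _ , f-edge) = dispatch (onLeft (splitAt a (f Fin.zero))) refl
    where
    onLeft : Fin a ⊎ Fin b → Bool
    onLeft (inj₁ _) = true
    onLeft (inj₂ _) = false
    same-side : ∀ p q → adj⊎ p q ≡ true → onLeft p ≡ onLeft q
    same-side (inj₁ _) (inj₁ _) _ = refl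
    same-side (inj₂ _) (inj₂ _) _ = refl
    constant : ∀ s → onLeft (splitAt a (f s)) ≡ onLeft (splitAt a (f Fin.zero))
    constant = Tmi-connected i k (onLeft ∘ splitAt a ∘ f)
      λ s t e → same-side (splitAt a (f s)) (splitAt a (f t)) (f-edge s t e)
    lefts : ∀ v → onLeft (splitAt a v) ≡ true → ∃[ x ] v ≡ x ↑ˡ b
    lefts v eq with splitAt a v in eq′
    ... | inj₁ x = x , ≡-sym (splitAt⁻¹-↑ˡ eq′)
    rights : ∀ v → onLeft (splitAt a v) ≡ false → ∃[ y ] v ≡ a ↑ʳ y
    rights v eq with splitAt a v in eq′
    ... | inj₂ y = y , ≡-sym (splitAt⁻¹-↑ʳ {m = a} eq′)
    dispatch : ∀ h → onLeft (splitAt a (f Fin.zero)) ≡ h → ⊥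
    dispatch true eq = free₁ i (corestrict {G = union G₁ G₂} {G₁ = G₁} {H = tree i k}
      (_↑ˡ b) adj-left c λ s → lefts (f s) (trans (constant s) eq))
    dispatch false eq = free₂ i (corestrict {G = union G₁ G₂} {G₁ = G₂} {H = tree i k}
      (a ↑ʳ_) adj-right c λ s → rights (f s) (trans (constant s) eq))

-- Minimum degree at least `c − 1`, given by explicit lists. Counting the vertex itself makes `c`
-- the order of a clique and leaves at most `N − c` non-neighbours.
ClosedNbhds≥ : ℕ → ∀ {N} → Graph N → Set
ClosedNbhds≥ c {N} G = ∀ v → ∃[ ls ] c ≤ length ls × Unique ls × All (λ u → u ≡ v ⊎ adj G v u ≡ true) ls

-- The graphs meant are the disjoint unions of cliques; `u ≢ w` excludes loops.
Transitive : ∀ {N} → Graph N → Set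
Transitive G = ∀ u v w → adj G u v ≡ true → adj G v w ≡ true → u ≢ w → adj G u w ≡ true

module _ {a b} {G₁ : Graph a} {G₂ : Graph b} where
  open Union G₁ G₂ hiding (union)

  union-closedNbhds : ∀ {c} → ClosedNbhds≥ c G₁ → ClosedNbhds≥ c G₂ → ClosedNbhds≥ c (union G₁ G₂)
  union-closedNbhds {c} nb₁ nb₂ v with side a b v
  ... | left x with nb₁ x
  ... | ls , le , u , near = map (_↑ˡ b) ls , subst (c ≤_) (≡-sym (length-map (_↑ˡ b) ls)) le ,
    Unique.map⁺ (↑ˡ-injective b _ _) u ,
    All.map⁺ (All.map [ inj₁ ∘ cong (_↑ˡ b) , inj₂ ∘ trans (adj-left _ _) ] near)
  union-closedNbhds {c} nb₁ nb₂ v | right y with nb₂ y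
  ... | ls , le , u , near = map (a ↑ʳ_) ls , subst (c ≤_) (≡-sym (length-map (a ↑ʳ_) ls)) le ,
    Unique.map⁺ (↑ʳ-injective a _ _) u ,
    All.map⁺ (All.map [ inj₁ ∘ cong (a ↑ʳ_) , inj₂ ∘ trans (adj-right _ _) ] near)

  union-transitive : Transitive G₁ → Transitive G₂ → Transitive (union G₁ G₂)
  union-transitive tr₁ tr₂ u v w uv vw u≢w with side a b u | side a b v | side a b w
  ... | left x | left y | left z = trans (adj-left x z)
    (tr₁ x y z (trans (≡-sym (adj-left x y)) uv) (trans (≡-sym (adj-left y z)) vw)
      (u≢w ∘ cong (_↑ˡ b)))
  ... | right x | right y | right z = trans (adj-right x z)
    (tr₂ x y z (trans (≡-sym (adj-right x y)) uv) (trans (≡-sym (adj-right y z)) vw)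
      (u≢w ∘ cong (a ↑ʳ_)))
  ... | left x | right y | _ = contradiction (trans (≡-sym uv) (adj-leftright x y)) λ ()
  ... | right x | left y | _ = contradiction (trans (≡-sym uv) (adj-rightleft y x)) λ ()
  ... | left _ | left y | right z = contradiction (trans (≡-sym vw) (adj-leftright y z)) λ ()
  ... | right _ | right y | left z = contradiction (trans (≡-sym vw) (adj-rightleft z y)) λ ()

module _ (N : ℕ) where
  open Complement (edgeless N) using (≁⁺; ≁⇒≢)

  complete-closedNbhds : ∀ {c} → c ≤ N → ClosedNbhds≥ c (complete N)
  complete-closedNbhds {c} le v = allFin N , subst (c ≤_) (≡-sym (length-tabulate id)) le ,
    Unique.allFin⁺ N , All.tabulate λ {u} _ → near u
    where
    near : ∀ u → u ≡ v ⊎ adj (complete N) v u ≡ true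
    near u with u ≟ v
    ... | yes eq = inj₁ eq
    ... | no ne = inj₂ (≁⁺ (ne ∘ ≡-sym) λ ())

  complete-transitive : Transitive (complete N)
  complete-transitive _ _ _ _ _ u≢w = ≁⁺ u≢w λ ()

  complete-treeFree : ∀ {k} → N < 5 + k → TreeFree k (complete N)
  complete-treeFree lt i (f , f-inj , _) = ≤⇒≯ (injective⇒≤ f-inj) lt

-- Large trees in the complement of a graph of given minimum degree

module Leaves {N} (G : Graph N) {M t} (t≤M : t ≤ M) (R : ℕ → ℕ → Set)
  (star : ∀ {y} → 1 ≤ y → y ≤ t → R 0 y) (copy : Contains G (mkPattern (suc M) R)) where
  private
    f = proj₁ copy
    index : Fin t → Fin (suc M)
    index s = Fin.suc (inject≤ s t≤M)

  leaves : List (Fin N)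
  leaves = tabulate (f ∘ index)

  length-leaves : length leaves ≡ t
  length-leaves = length-tabulate (f ∘ index)

  leaves-unique : Unique leaves
  leaves-unique = Unique.tabulate⁺ λ {s} {t} eq →
    inject≤-injective t≤M t≤M s t (suc-injective (proj₁ (proj₂ copy) eq))

  leaves-adjacent : ∀ {u} → u ∈ leaves → adj G (f Fin.zero) u ≡ true
  leaves-adjacent u∈ with ∈-tabulate⁻ u∈
  ... | s , refl = proj₂ (proj₂ copy) Fin.zero (index s)
    (star (s≤s z≤n) (subst (_< t) (≡-sym (toℕ-inject≤ s t≤M)) (toℕ<n s)))

  leaves-∌ : ∀ {s} → t < toℕ s → f s ∉ leaves
  leaves-∌ {s} lt f∈ with ∈-tabulate⁻ f∈
  ... | s′ , eq = <⇒≱ lt (subst (_≤ t) (cong toℕ (≡-sym (proj₁ (proj₂ copy) eq)))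
    (subst (_< t) (≡-sym (toℕ-inject≤ s′ t≤M)) (toℕ<n s′)))

module _ {N} {G : Graph N} where
  open Embed G
  open Complement G

  far-bound : ∀ {c} → ClosedNbhds≥ c G → ∀ {v ys} → Unique ys → (∀ {y} → y ∈ ys → v ≁ y) →
    length ys + c ≤ N
  far-bound {c} nb {v} {ys} u far with nb v
  ... | ls , le , uls , near = ≤-trans (+-monoʳ-≤ (length ys) le)
    (subst (_≤ N) (length-++ ys) (unique-length≤ (Unique.++⁺ u uls disjoint)))
    where
    disjoint : ∀ {y} → y ∈ ys × y ∈ ls → ⊥
    disjoint (y∈ys , y∈ls) with All.lookup near y∈ls
    ... | inj₁ refl = ≁⇒≢ (far y∈ys) refl
    ... | inj₂ e = ≁⇒¬~ (far y∈ys) e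

  -- The centre of `T'` would need `1 + j` non-neighbours in `G`, disjoint from its closed
  -- neighbourhood of order at least `c`.
  T'-free : ∀ {c j} → ClosedNbhds≥ c G → N < (1 + j) + c → ¬ Contains (complement G) (T' (3 + j))
  T'-free {c} {j} nb lt copy = ≤⇒≯
    (subst (λ l → l + c ≤ N) length-leaves (far-bound nb leaves-unique leaves-adjacent)) lt
    where
    open Leaves (complement G) (n≤1+n (1 + j)) (E (T' (3 + j))) (λ p q → inj₁ (refl , p , q)) copy

  module _ {c j} (nb : ClosedNbhds≥ c G) (copy : Contains (complement G) (T* (4 + j))) where
    open Leaves (complement G) (m≤n+m (1 + j) 2) (E (T* (4 + j))) (λ p q → inj₁ (refl , p , q)) copy

    T*-bound : (1 + j) + c ≤ N
    T*-bound = subst (λ l → l + c ≤ N) length-leaves (far-bound nb leaves-unique leaves-adjacent)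

    -- Otherwise both tail vertices lie in the closed neighbourhood of the centre, a clique of G.
    T*-transitive-bound : Transitive G → (2 + j) + c ≤ N
    T*-transitive-bound tr = bound
      where
      f = proj₁ copy
      v = f Fin.zero
      -- A tail vertex that is also a non-neighbour of the centre adds one to the count of `leaves`.
      beyond : ∀ {s} → 1 + j < toℕ s → v ≁ f s → (2 + j) + c ≤ N
      beyond {s} lt far = subst (λ l → suc l + c ≤ N) length-leaves
        (far-bound nb {ys = f s ∷ leaves}
          (All.tabulate (λ { y∈ refl → leaves-∌ lt y∈ }) ∷ leaves-unique)
          λ { (here refl) → far ; (there y∈) → leaves-adjacent y∈ })
      inner outer : Fin (4 + j)
      inner = fromℕ< {2 + j} (n≤1+n (3 + j))
      outer = fromℕ< {3 + j} ≤-refl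
      toℕ-inner : toℕ inner ≡ 2 + j
      toℕ-inner = toℕ-fromℕ< (n≤1+n (3 + j))
      toℕ-outer : toℕ outer ≡ 3 + j
      toℕ-outer = toℕ-fromℕ< {3 + j} ≤-refl
      ≢v : ∀ {s x} → toℕ s ≡ suc x → v ≢ f s
      ≢v {s} eq v≡ with proj₁ (proj₂ copy) {Fin.zero} {s} v≡
      ≢v () v≡ | refl
      bound : (2 + j) + c ≤ N
      bound with adj G v (f inner) Bool.≟ true | adj G v (f outer) Bool.≟ true
      ... | no ¬e | _ = beyond {inner}
        (≤-reflexive (≡-sym toℕ-inner)) (≁⁺ (≢v toℕ-inner) ¬e)
      ... | _ | no ¬e = beyond {outer}
        (≤-trans (n≤1+n _) (≤-reflexive (≡-sym toℕ-outer))) (≁⁺ (≢v toℕ-outer) ¬e)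
      ... | yes vi | yes vo = contradiction (tr _ _ _ (~-sym vi) vo (≁⇒≢ tail)) (≁⇒¬~ tail)
        where
        tail : f inner ≁ f outer
        tail = proj₂ (proj₂ copy) inner outer (inj₂ (inj₂ (toℕ-inner , toℕ-outer)))

does-≡-sym : ∀ {N} (u v : Fin N) → does (u ≟ v) ≡ does (v ≟ u)
does-≡-sym u v with u ≟ v | v ≟ u
... | yes _ | yes _ = refl
... | no _ | no _ = refl
... | yes p | no q = contradiction (≡-sym p) q
... | no p | yes q = contradiction (≡-sym q) p

-- Edges with colour below d, for a proper edge colouring of the complete graph on r + 1 vertices
-- with r colours: every colour class is a perfect matching, so this graph is d-regular.
module ColourClasses {r} (col : Fin (suc r) → Fin (suc r) → ℕ) (col-sym : ∀ u v → col u v ≡ col v u)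
  (col< : ∀ u v → col u v < r)
  (proper : ∀ {u v w} → v ≢ u → w ≢ u → col u v ≡ col u w → v ≡ w) (d : ℕ) (d≤r : d ≤ r) where

  joined? : ∀ u v → Dec (u ≢ v × col u v < d)
  joined? u v = ¬? (u ≟ v) ×-dec (col u v <? d)

  classes : Graph (suc r)
  classes = record
    { adj = λ u v → does (joined? u v)
    ; sym = λ u v → cong₂ _∧_ (cong not (does-≡-sym u v)) (cong (λ x → does (x <? d)) (col-sym u v))
    ; irref = λ v → cong (λ b → not b ∧ does (col v v <? d)) (dec-true (v ≟ v) refl) }

  open Embed classes
  open Complement classes

  edge⁻ : ∀ {u v} → u ~ v → u ≢ v × col u v < d
  edge⁻ {u} {v} = does-true (joined? u v)
    where
    does-true : ∀ {A : Set} (a? : Dec A) → does a? ≡ true → A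
    does-true (yes a) _ = a

  edge⁺ : ∀ {u v} → u ≢ v → col u v < d → u ~ v
  edge⁺ {u} {v} u≢v lt = dec-true (joined? u v) (u≢v , lt)

  -- Distinct neighbours receive distinct colours below `d`. In the same way non-neighbours inject
  -- into the other `r ∸ d` colours, and both bounds together force degree exactly `d`.
  degree≤ : ∀ v → length (nbrs classes v) ≤ d
  degree≤ v = subst (length (nbrs classes v) ≤_) (length-applyUpTo id d)
    (injection-length (col v) (nbrs-unique classes v)
    (λ x∈ y∈ → proper (ne x∈) (ne y∈)) λ x∈ → ∈-upTo⁺ (proj₂ (edge⁻ (∈-nbrs⁻ classes x∈))))
    where
    ne : ∀ {u} → u ∈ nbrs classes v → u ≢ v
    ne x∈ = proj₁ (edge⁻ (∈-nbrs⁻ classes x∈)) ∘ ≡-sym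

  codegree≤ : ∀ v → length (nbrs (complement classes) v) ≤ r ∸ d
  codegree≤ v = subst (length (nbrs (complement classes) v) ≤_) (length-applyUpTo (d +_) (r ∸ d))
    (injection-length (col v) (nbrs-unique (complement classes) v)
      (λ x∈ y∈ → proper (≁⇒≢ (far x∈) ∘ ≡-sym) (≁⇒≢ (far y∈) ∘ ≡-sym)) colour∈)
    where
    far : ∀ {u} → u ∈ nbrs (complement classes) v → v ≁ u
    far {u} = ∈-nbrs⁻ (complement classes) {u} {v}
    colour∈ : ∀ {u} → u ∈ nbrs (complement classes) v → col v u ∈ applyUpTo (d +_) (r ∸ d)
    colour∈ {u} u∈ = subst (_∈ applyUpTo (d +_) (r ∸ d)) (m+[n∸m]≡n d≤)
      (∈-applyUpTo⁺ (d +_) (∸-monoˡ-< (col< v u) d≤))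
      where
      d≤ : d ≤ col v u
      d≤ = ≮⇒≥ λ lt → ≁⇒¬~ (far u∈) (edge⁺ (≁⇒≢ (far u∈)) lt)

  classes-closedNbhds : ClosedNbhds≥ (suc d) classes
  classes-closedNbhds v = v ∷ nbrs classes v , s≤s degree≥ ,
    All.tabulate (λ u∈ → ~⇒≢ (∈-nbrs⁻ classes u∈)) ∷ nbrs-unique classes v ,
    inj₁ refl ∷ All.tabulate (inj₂ ∘ ∈-nbrs⁻ classes)
    where
    degree≥ : d ≤ length (nbrs classes v)
    degree≥ = +-cancelʳ-≤ (r ∸ d) d _ (subst (_≤ length (nbrs classes v) + (r ∸ d))
      (≡-sym (m+[n∸m]≡n d≤r))
      (≤-trans (≤-pred (degree-sum v)) (+-monoʳ-≤ (length (nbrs classes v)) (codegree≤ v))))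

  classes-treeFree : ∀ {k} → d < 2 + k → TreeFree k classes
  classes-treeFree {k} d< i copy = <⇒≱ d< (≤-trans (≤-reflexive (≡-sym length-leaves))
    (≤-trans (⊆-length leaves-unique (λ u∈ → ∈-nbrs⁺ classes (leaves-adjacent u∈)))
      (degree≤ (proj₁ copy Fin.zero))))
    where
    open Leaves classes (m≤n+m (2 + k) 2) (E (Tmi i (5 + k))) (Tmi-star i k) copy

-- Extremal graphs: unions of cliques, and a clique with a regular graph

CliqueUnion : ℕ → ℕ → Set
CliqueUnion k N = Σ (Graph N) λ G → TreeFree k G × ClosedNbhds≥ (3 + k) G × Transitive G

-- The cliques have orders `m − 1` and `m − 2`, too small for a tree on `m` vertices, and every
-- closed neighbourhood has at least `m − 2` vertices.
clique-union : ∀ k x y → CliqueUnion k (x * (4 + k) + y * (3 + k))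
clique-union k zero zero = complete 0 , complete-treeFree 0 (s≤s z≤n) , (λ ()) , complete-transitive 0
clique-union k zero (suc y) with clique-union k zero y
... | G , free , nb , tr = union (complete (3 + k)) G ,
  union-treeFree (complete-treeFree (3 + k) (n≤1+n (4 + k))) free ,
  union-closedNbhds (complete-closedNbhds (3 + k) ≤-refl) nb ,
  union-transitive {G₁ = complete (3 + k)} {G} (complete-transitive (3 + k)) tr
clique-union k (suc x) y with clique-union k x y
... | G , free , nb , tr = subst (CliqueUnion k) (≡-sym (+-assoc (4 + k) (x * (4 + k)) (y * (3 + k))))
  (union (complete (4 + k)) G ,
  union-treeFree (complete-treeFree (4 + k) ≤-refl) free ,
  union-closedNbhds (complete-closedNbhds (4 + k) (n≤1+n (3 + k))) nb ,
  union-transitive {G₁ = complete (4 + k)} {G} (complete-transitive (4 + k)) tr)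

RegularUnion : ℕ → ℕ → Set
RegularUnion k N = Σ (Graph N) λ G → TreeFree k G × ClosedNbhds≥ (2 + k) G

parity : ∀ x → ∃[ t ] (x ≡ t + t ⊎ x ≡ suc (t + t))
parity zero = 0 , inj₁ refl
parity (suc x) with parity x
... | t , inj₁ refl = t , inj₂ refl
... | t , inj₂ refl = suc t , inj₁ (cong suc (≡-sym (+-suc t t)))

-- Taking `suc k = m − 4` perfect matchings keeps every degree below the `m − 3` that the root of
-- the tree requires.
regular-even : ∀ k t → k ≤ t + t → RegularUnion k (2 + (t + t))
regular-even k t k≤ = classes , classes-treeFree ≤-refl , classes-closedNbhds
  where
  open RoundRobin t
  bound : ∀ (v : Fin (suc r)) → toℕ v ≤ r
  bound v = ≤-pred (toℕ<n v)
  open ColourClasses (λ u v → colour (toℕ u) (toℕ v)) (λ u v → colour-sym (toℕ u) (toℕ v))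
    (λ u v → m%n<n (colourSum (toℕ u) (toℕ v)) r)
    (λ {u} {v} {w} v≢u w≢u eq → toℕ-injective (colour-injective (bound u) (bound v) (bound w)
      (v≢u ∘ toℕ-injective) (w≢u ∘ toℕ-injective) eq))
    (suc k) (s≤s k≤)

-- The 1-factorisation requires an even order, so the parity of `k + l` decides whether the clique
-- has `m − 2` or `m − 3` vertices.
regular-union : ∀ k l → RegularUnion k (5 + k + (k + l))
regular-union k l with parity (k + l)
... | t , inj₁ eq with regular-even k t (subst (k ≤_) eq (m≤m+n k l))
... | G , free , nb = subst (RegularUnion k) size-eq
  (union (complete (3 + k)) G ,
  union-treeFree (complete-treeFree (3 + k) (n≤1+n (4 + k))) free ,
  union-closedNbhds (complete-closedNbhds (3 + k) (n≤1+n (2 + k))) nb)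
  where
  rearrange : ∀ k t → 3 + k + (2 + (t + t)) ≡ 5 + k + (t + t)
  rearrange = solve-∀
  size-eq : 3 + k + (2 + (t + t)) ≡ 5 + k + (k + l)
  size-eq = trans (rearrange k t) (cong (5 + k +_) (≡-sym eq))
regular-union k l | t , inj₂ eq
  with regular-even k (suc t) (≤-trans (subst (k ≤_) eq (m≤m+n k l)) (s≤s (+-monoʳ-≤ t (n≤1+n t))))
... | G , free , nb = subst (RegularUnion k) size-eq
  (union (complete (2 + k)) G ,
  union-treeFree (complete-treeFree (2 + k) (m≤n+m (3 + k) 2)) free ,
  union-closedNbhds (complete-closedNbhds (2 + k) ≤-refl) nb)
  where
  rearrange : ∀ k t → 2 + k + (2 + (suc t + suc t)) ≡ 5 + k + suc (t + t)
  rearrange = solve-∀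
  size-eq : 2 + k + (2 + (suc t + suc t)) ≡ 5 + k + (k + l)
  size-eq = trans (rearrange k t) (cong (5 + k +_) (≡-sym eq))

tree≡Tmi : ∀ i k → tree i k ≡ Tmi i (5 + k)
tree≡Tmi Fin.zero k = refl
tree≡Tmi (Fin.suc _) k = refl

¬arrows : ∀ {k N H} i (G : Graph N) → TreeFree k G → ¬ Contains (complement G) H →
  ¬ Arrows N (Tmi i (5 + k)) H
¬arrows {k} i G free free′ arrows with arrows G
... | inj₁ c = free i (subst (Contains G) (≡-sym (tree≡Tmi i k)) c)
... | inj₂ c = free′ c

-- Monotonicity of the arrow relation

induced : ∀ {M N} (ι : Fin M → Fin N) → Graph N → Graph M
induced ι G = record
  { adj = λ u v → adj G (ι u) (ι v)
  ; sym = λ u v → Graph.sym G (ι u) (ι v)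
  ; irref = λ v → irref G (ι v) }

module _ {M N} (ι : Fin M → Fin N) (ι-inj : Injective _≡_ _≡_ ι) where
  copy-extend : ∀ {G₁ : Graph M} {G : Graph N} {H} →
    (∀ {u v} → adj G₁ u v ≡ true → adj G (ι u) (ι v) ≡ true) → Contains G₁ H → Contains G H
  copy-extend hom (f , f-inj , f-edge) = ι ∘ f , f-inj ∘ ι-inj , λ s t e → hom (f-edge s t e)

  Arrows-extend : ∀ {H₁ H₂} → Arrows M H₁ H₂ → Arrows N H₁ H₂
  Arrows-extend {H₁} {H₂} arrows G with arrows (induced ι G)
  ... | inj₁ c = inj₁ (copy-extend {induced ι G} {G} {H₁} id c)
  ... | inj₂ c = inj₂ (copy-extend {complement (induced ι G)} {complement G} {H₂}
    (λ {u} {v} e → Complement.≁⁺ G (Complement.≁⇒≢ (induced ι G) {u} {v} e ∘ ι-inj)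
      (Complement.≁⇒¬~ (induced ι G) {u} {v} e)) c)

Arrows-mono : ∀ {H₁ H₂ M N} → M ≤ N → Arrows M H₁ H₂ → Arrows N H₁ H₂
Arrows-mono {H₁} {H₂} le = Arrows-extend (λ v → inject≤ v le) (inject≤-injective le le _ _) {H₁} {H₂}

-- By monotonicity, failure at `R` alone settles all smaller orders.
isRamsey : ∀ {H₁ H₂ R} → Arrows (suc R) H₁ H₂ → ¬ Arrows R H₁ H₂ → IsRamseyNumber H₁ H₂ (suc R)
isRamsey {H₁} {H₂} yes! no! = s≤s z≤n , yes! ,
  λ M _ M<R arrows → no! (Arrows-mono {H₁} {H₂} (≤-pred M<R) arrows)

-- Existence of the Ramsey numbers

Searchable : Set → Set₁
Searchable A = {P : A → Set} → (∀ a → Dec (P a)) → Dec (∃ P)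

search-Bool : Searchable Bool
search-Bool P? = map′ [ (true ,_) , (false ,_) ]
  (λ { (true , p) → inj₁ p ; (false , p) → inj₂ p }) (P? true ⊎-dec P? false)

-- Vectors stand for maps out of a finite set: a predicate on functions need not respect pointwise
-- equality, so functions themselves could not be enumerated.
search-Vec : ∀ {A} → Searchable A → ∀ n → Searchable (Vec A n)
search-Vec search zero P? = map′ ([] ,_) (λ { ([] , p) → p }) (P? [])
search-Vec search (suc n) P? = map′ (λ (x , xs , p) → x ∷ xs , p) (λ { (x ∷ xs , p) → x , xs , p })
  (search λ x → search-Vec search n λ xs → P? (x ∷ xs))

module _ {H} (E? : ∀ x y → Dec (E H x y)) where
  contains? : ∀ {N} (G : Graph N) → Dec (Contains G H)
  contains? {N} G = map′
    (λ { (fs , inj , edge) → lookup fs , (λ {s} {t} → inj s t) , edge })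
    (λ (f , inj , edge) → Vec.tabulate f ,
      (λ s t eq → inj (trans (≡-sym (lookup∘tabulate f s)) (trans eq (lookup∘tabulate f t)))) ,
      λ s t e → trans (cong₂ (adj G) (lookup∘tabulate f s) (lookup∘tabulate f t)) (edge s t e))
    (search-Vec any? (size H) λ fs →
      all? (λ s → all? λ t → (lookup fs s ≟ lookup fs t) →-dec (s ≟ t))
      ×-dec all? (λ s → all? λ t → E? (toℕ s) (toℕ t)
        →-dec (adj G (lookup fs s) (lookup fs t) Bool.≟ true)))

-- Symmetrising an arbitrary Boolean matrix makes every matrix a graph.
fromMatrix : ∀ {N} → Vec (Vec Bool N) N → Graph N
fromMatrix bs = record
  { adj = λ u v → not (does (u ≟ v)) ∧ (entry u v ∧ entry v u)
  ; sym = λ u v → cong₂ _∧_ (cong not (does-≡-sym u v)) (Bool.∧-comm (entry u v) (entry v u))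
  ; irref = λ v → cong (λ b → not b ∧ (entry v v ∧ entry v v)) (dec-true (v ≟ v) refl) }
  where
  entry : _ → _ → Bool
  entry u v = lookup (lookup bs u) v

toMatrix : ∀ {N} → Graph N → Vec (Vec Bool N) N
toMatrix G = Vec.tabulate λ u → Vec.tabulate (adj G u)

fromMatrix-toMatrix : ∀ {N} (G : Graph N) u v → adj (fromMatrix (toMatrix G)) u v ≡ adj G u v
fromMatrix-toMatrix G u v rewrite lookup∘tabulate (λ u → Vec.tabulate (adj G u)) u
  | lookup∘tabulate (λ u → Vec.tabulate (adj G u)) v
  | lookup∘tabulate (adj G u) v | lookup∘tabulate (adj G v) u | Graph.sym G v u with u ≟ v
... | yes refl = ≡-sym (irref G u)
... | no _ = Bool.∧-idem (adj G u v)

module _ {H₁ H₂} (E₁? : ∀ x y → Dec (E H₁ x y)) (E₂? : ∀ x y → Dec (E H₂ x y)) where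

  arrows? : ∀ N → Dec (Arrows N H₁ H₂)
  arrows? N with search-Vec (search-Vec search-Bool N) N (λ bs →
      ¬? (contains? {H₁} E₁? (fromMatrix bs))
        ×-dec ¬? (contains? {H₂} E₂? (complement (fromMatrix bs))))
  ... | yes (bs , no₁ , no₂) = no λ arrows → [ no₁ , no₂ ] (arrows (fromMatrix bs))
  ... | no none = yes λ G → decide G (contains? {H₁} E₁? G) (contains? {H₂} E₂? (complement G))
    where
    decide : ∀ G → Dec (Contains G H₁) → Dec (Contains (complement G) H₂) →
      Contains G H₁ ⊎ Contains (complement G) H₂
    decide G (yes c) _ = inj₁ c
    decide G (no _) (yes c) = inj₂ c
    decide G (no no₁) (no no₂) = contradiction (toMatrix G ,
      (λ c → no₁ (copy-extend id id {fromMatrix (toMatrix G)} {G} {H₁}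
        (λ {u} {v} e → trans (≡-sym (fromMatrix-toMatrix G u v)) e) c)) ,
      (λ c → no₂ (copy-extend id id {complement (fromMatrix (toMatrix G))} {complement G} {H₂}
        (λ {u} {v} e → trans (cong (λ b → if does (u ≟ v) then false else not b)
          (≡-sym (fromMatrix-toMatrix G u v))) e) c))) none

  -- The orders above `L` are decided one after another; the first that arrows is the Ramsey number,
  -- and it comes after at most `d` steps.
  ramsey-exists : ∀ d L → ¬ Arrows L H₁ H₂ → Arrows (d + L) H₁ H₂ →
    Σ ℕ λ r → IsRamseyNumber H₁ H₂ r × suc L ≤ r × r ≤ d + L
  ramsey-exists zero L no! yes! = contradiction yes! no!
  ramsey-exists (suc d) L no! yes! with arrows? (suc L)
  ... | yes arrows = suc L , isRamsey {H₁} {H₂} arrows no! , ≤-refl , s≤s (m≤n+m L d)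
  ... | no ¬arrows with ramsey-exists d (suc L) ¬arrows
    (subst (λ N → Arrows N H₁ H₂) (≡-sym (+-suc d L)) yes!)
  ... | r , isR , lower , upper = r , isR ,
    ≤-trans (n≤1+n _) lower , ≤-trans upper (≤-reflexive (+-suc d L))

Tmi? : ∀ i m x y → Dec (E (Tmi i m) x y)
Tmi? Fin.zero m x y = (x ℕ.≟ 0 ×-dec 1 ≤? y ×-dec y ≤? m ∸ 3)
  ⊎-dec (x ℕ.≟ m ∸ 4 ×-dec y ℕ.≟ m ∸ 2) ⊎-dec (x ℕ.≟ m ∸ 3 ×-dec y ℕ.≟ m ∸ 1)
Tmi? (Fin.suc _) m x y = (x ℕ.≟ 0 ×-dec 1 ≤? y ×-dec y ≤? m ∸ 3)
  ⊎-dec (x ℕ.≟ m ∸ 3 ×-dec y ℕ.≟ m ∸ 2) ⊎-dec (x ℕ.≟ m ∸ 3 ×-dec y ℕ.≟ m ∸ 1)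

T'? : ∀ n x y → Dec (E (T' n) x y)
T'? n x y = (x ℕ.≟ 0 ×-dec 1 ≤? y ×-dec y ≤? n ∸ 2) ⊎-dec (x ℕ.≟ n ∸ 2 ×-dec y ℕ.≟ n ∸ 1)

T*? : ∀ n x y → Dec (E (T* n) x y)
T*? n x y = (x ℕ.≟ 0 ×-dec 1 ≤? y ×-dec y ≤? n ∸ 3)
  ⊎-dec (x ℕ.≟ n ∸ 3 ×-dec y ℕ.≟ n ∸ 2) ⊎-dec (x ℕ.≟ n ∸ 2 ×-dec y ℕ.≟ n ∸ 1)

-- Numerical conditions and conclusion

CliqueSizes : ℕ → ℕ → Set
CliqueSizes k N = ∃[ x ] ∃[ y ] N ≡ x * (4 + k) + y * (3 + k)

-- N = Q(m − 2) + A: enlarge A of the Q cliques by one vertex.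
enlarge : ∀ k {N Q A} → N ≡ Q * (3 + k) + A → A ≤ Q → CliqueSizes k N
enlarge k {A = A} refl A≤Q with m≤n⇒∃[o]m+o≡n A≤Q
... | z , refl = A , z , identity k A z
  where
  identity : ∀ k A z → (A + z) * (3 + k) + A ≡ A * (4 + k) + z * (3 + k)
  identity = solve-∀

-- N + y = X(m − 1): remove one vertex from y of the X cliques.
shrink : ∀ k {N X} y → N + y ≡ X * (4 + k) → y ≤ X → CliqueSizes k N
shrink k {N} y eq y≤X with m≤n⇒∃[o]m+o≡n y≤X
... | z , refl = z , y , +-cancelʳ-≡ y N _ (trans eq (identity k y z))
  where
  identity : ∀ k y z → (y + z) * (4 + k) ≡ z * (4 + k) + y * (3 + k) + y
  identity = solve-∀

Sharp : (k n K a b : ℕ) → Set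
Sharp k n K a b = (b ≡ 1 ⊎ b ≡ 2 ⊎ b ≡ 4)
  ⊎ (b ≡ 0 × K ≥ 3)
  ⊎ n ≥ (2 + k) * (2 + k) + 2
  ⊎ n ≥ ((5 + k) * (5 + k) ∸ 1) ∸ b * (3 + k)
  ⊎ (a ≥ 3 × n ≥ (a ∸ 4) * (4 + k) + 4)

-- The order `k + n` is `m + n − 5`. For `b ≤ 4` it falls `4 − b` vertices short of `suc K` cliques
-- of order `m − 1`, so (1) and (2) work once `4 − b ≤ suc K`; for `b = 1` this uses `n > m`.
cliqueSizes : ∀ k {n} K q a b → 5 + k < n → 1 ≤ K → b ≤ 3 + k →
  n ≡ K * (4 + k) + b → n ≡ q * (3 + k) + a → Sharp k n K a b → CliqueSizes k (k + n)
cliqueSizes k K q a b m<n 1≤K b≤ refl n≡ (inj₁ (inj₁ refl)) =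
  shrink k {X = suc K} 3 (identity k K) (s≤s (2≤ K m<n))
  where
  identity : ∀ k K → k + (K * (4 + k) + 1) + 3 ≡ suc K * (4 + k)
  identity = solve-∀
  2≤ : ∀ K → 5 + k < K * (4 + k) + 1 → 2 ≤ K
  2≤ zero (s≤s ())
  2≤ (suc zero) lt = contradiction lt (≤⇒≯ (≤-reflexive (one k)))
    where
    one : ∀ k → 1 * (4 + k) + 1 ≡ 5 + k
    one = solve-∀
  2≤ (suc (suc _)) _ = s≤s (s≤s z≤n)
cliqueSizes k K q a b m<n 1≤K b≤ refl n≡ (inj₁ (inj₂ (inj₁ refl))) =
  shrink k {X = suc K} 2 (identity k K) (s≤s 1≤K)
  where
  identity : ∀ k K → k + (K * (4 + k) + 2) + 2 ≡ suc K * (4 + k)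
  identity = solve-∀
cliqueSizes k K q a b m<n 1≤K b≤ refl n≡ (inj₁ (inj₂ (inj₂ refl))) =
  shrink k {X = suc K} 0 (identity k K) z≤n
  where
  identity : ∀ k K → k + (K * (4 + k) + 4) + 0 ≡ suc K * (4 + k)
  identity = solve-∀
cliqueSizes k K q a b m<n 1≤K b≤ refl n≡ (inj₂ (inj₁ (refl , 3≤K))) =
  shrink k {X = suc K} 4 (identity k K) (s≤s 3≤K)
  where
  identity : ∀ k K → k + (K * (4 + k) + 0) + 4 ≡ suc K * (4 + k)
  identity = solve-∀
-- Condition (3) gives `N ≥ (m − 3)(m − 2)`, so on division by `m − 2` the quotient is at least
-- `m − 3`, the largest possible remainder.
cliqueSizes k {n} K q a b m<n 1≤K b≤ _ _ (inj₂ (inj₂ (inj₁ large))) =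
  enlarge k {Q = N / (3 + k)} {A = N % (3 + k)}
    (trans (m≡m%n+[m/n]*n N (3 + k)) (+-comm (N % (3 + k)) (N / (3 + k) * (3 + k))))
    (≤-trans (≤-pred (m%n<n N (3 + k)))
      (subst (_≤ N / (3 + k)) (m*n/n≡m (2 + k) (3 + k)) (/-mono-≤ product≤N (≤-refl {3 + k}))))
  where
  N = k + n
  identity : ∀ k → (2 + k) * (3 + k) ≡ k + ((2 + k) * (2 + k) + 2)
  identity = solve-∀
  product≤N : (2 + k) * (3 + k) ≤ N
  product≤N = subst (_≤ N) (≡-sym (identity k)) (+-monoʳ-≤ k large)
-- For (4), start from `2 + K` cliques of order `m − 1` and remove `y = m + 3 − b` vertices. As
-- `m² − 1 = (m + 1)(m − 1)`, the condition amounts to `K + b ≥ m + 1`, that is `y ≤ 2 + K`.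
cliqueSizes k K q a b m<n 1≤K b≤ refl _ (inj₂ (inj₂ (inj₂ (inj₁ large))))
  with m≤n⇒∃[o]m+o≡n {b} {8 + k} (≤-trans b≤ (m≤n+m (3 + k) 5))
... | y , b+y≡ = shrink k {X = 2 + K} y sum≡
  (+-cancelˡ-≤ b y (2 + K) (subst (_≤ b + (2 + K)) (≡-sym b+y≡)
    (≤-trans (+-monoʳ-≤ 2 blocks) (≤-reflexive (reorder K b)))))
  where
  open ≤-Reasoning
  reorder : ∀ K b → 2 + (K + b) ≡ b + (2 + K)
  reorder = solve-∀
  square : ∀ k → (5 + k) * (5 + k) ≡ suc ((6 + k) * (4 + k))
  square = solve-∀
  regroup : ∀ k K b → b * (3 + k) + (K * (4 + k) + b) ≡ (K + b) * (4 + k)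
  regroup = solve-∀
  blocks : 6 + k ≤ K + b
  blocks = *-cancelʳ-≤ (6 + k) (K + b) (4 + k) (begin
    (6 + k) * (4 + k)                                      ≡⟨ cong (_∸ 1) (square k) ⟨
    (5 + k) * (5 + k) ∸ 1                                  ≤⟨ m≤n+m∸n _ (b * (3 + k)) ⟩
    b * (3 + k) + ((5 + k) * (5 + k) ∸ 1 ∸ b * (3 + k))    ≤⟨ +-monoʳ-≤ (b * (3 + k)) large ⟩
    b * (3 + k) + (K * (4 + k) + b)                        ≡⟨ regroup k K b ⟩
    (K + b) * (4 + k)                                      ∎)
  regroup′ : ∀ k K b y → k + (K * (4 + k) + b) + y ≡ K * (4 + k) + k + (b + y)
  regroup′ = solve-∀
  total : ∀ k K → K * (4 + k) + k + (8 + k) ≡ (2 + K) * (4 + k)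
  total = solve-∀
  sum≡ : k + (K * (4 + k) + b) + y ≡ (2 + K) * (4 + k)
  sum≡ = trans (regroup′ k K b y) (trans (cong (K * (4 + k) + k +_) b+y≡) (total k K))
-- For (5), three of the surplus vertices join the `k` extra ones to form another clique of order
-- `m − 2`, and the other `a − 3` enlarge cliques. When `a = 3` nothing is left over, and the
-- truncated `a ∸ 4` is harmless.
cliqueSizes k {n} K q (suc (suc (suc a))) b m<n 1≤K b≤ _ n≡
  (inj₂ (inj₂ (inj₂ (inj₂ (s≤s (s≤s (s≤s _)) , large))))) =
  enlarge k (trans (cong (k +_) n≡) (identity k q a)) (a≤ a (subst (_ ≤_) n≡ large))
  where
  identity : ∀ k q a → k + (q * (3 + k) + (3 + a)) ≡ suc q * (3 + k) + a
  identity = solve-∀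
  expand : ∀ k a → a * (4 + k) + 4 ≡ a * (3 + k) + (4 + a)
  expand = solve-∀
  a≤ : ∀ a → (3 + a ∸ 4) * (4 + k) + 4 ≤ q * (3 + k) + (3 + a) → a ≤ suc q
  a≤ zero _ = z≤n
  a≤ (suc a) large = s≤s (*-cancelʳ-≤ a q (3 + k) (+-cancelʳ-≤ (4 + a) _ _
    (subst (_≤ q * (3 + k) + (4 + a)) (expand k a) large)))

RamseyBetween : Pattern → Pattern → ℕ → ℕ → Set
RamseyBetween H₁ H₂ lo hi = Σ ℕ λ r → IsRamseyNumber H₁ H₂ r × lo ≤ r × r ≤ hi

module Bounds (i : Fin 2) (k l : ℕ) (∤ : ¬ (4 + k ∣ 3 + k + l)) where

  m n : ℕ
  m = 5 + k
  n = 6 + k + l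

  N≡ : suc (k + n) ≡ 4 + k + (3 + k + l)
  N≡ = identity k l
    where
    identity : ∀ k l → suc (k + (6 + k + l)) ≡ 4 + k + (3 + k + l)
    identity = solve-∀

  -- This holds because `m + n − 4 = (m − 1) + (n − 3)`.
  ∤N : ¬ (4 + k ∣ suc (k + n))
  ∤N d = ∤ (∣m+n∣m⇒∣n (subst (4 + k ∣_) N≡ d) ∣-refl)

  arrows-T' : Arrows (suc (k + n)) (Tmi i m) (T' n)
  arrows-T' G = T'-upper G i k (3 + k + l) N≡ (m≤m+n (3 + k) l) ∤N

  arrows-T* : Arrows (suc (k + n)) (Tmi i m) (T* n)
  arrows-T* G = T*-upper G i k (2 + k + l)
    (trans N≡ (cong (4 +_) (+-suc k (2 + k + l)))) (m≤m+n (2 + k) l) ∤N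

  ¬arrows-cliques : CliqueSizes k (k + n) →
    ¬ Arrows (k + n) (Tmi i m) (T' n) × ¬ Arrows (k + n) (Tmi i m) (T* n)
  ¬arrows-cliques (x , y , eq) with subst (CliqueUnion k) (≡-sym eq) (clique-union k x y)
  ... | G , free , nb , tr =
    ¬arrows {H = T' n} i G free (T'-free {G = G} nb (≤-reflexive (identity k l))) ,
    ¬arrows {H = T* n} i G free (λ c → ≤⇒≯ (T*-transitive-bound {G = G} nb c tr)
      (≤-reflexive (identity k l)))
    where
    identity : ∀ k l → suc (k + (6 + k + l)) ≡ 4 + k + l + (3 + k)
    identity = solve-∀

  -- On `m + n − 6` vertices, closed neighbourhoods of order at least `m − 3` leave at most `n − 3`
  -- non-neighbours, one fewer than the centre of `T'` requires.
  ¬arrows-regular-T' : ¬ Arrows (k + (5 + k + l)) (Tmi i m) (T' n)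
  ¬arrows-regular-T' with subst (RegularUnion k) (identity k l) (regular-union k l)
    where
    identity : ∀ k l → 5 + k + (k + l) ≡ k + (5 + k + l)
    identity = solve-∀
  ... | G , free , nb = ¬arrows {H = T' n} i G free (T'-free {G = G} nb (≤-reflexive (identity k l)))
    where
    identity : ∀ k l → suc (k + (5 + k + l)) ≡ 4 + k + l + (2 + k)
    identity = solve-∀

  ramsey-T' : RamseyBetween (Tmi i m) (T' n) (m + n ∸ 5) (m + n ∸ 4)
  ramsey-T' = subst₂ (RamseyBetween (Tmi i m) (T' n)) lower≡ (cong suc lower≡)
    (ramsey-exists {Tmi i m} {T' n} (Tmi? i m) (T'? n) 2 (k + (5 + k + l)) ¬arrows-regular-T'
      (subst (λ N → Arrows N (Tmi i m) (T' n)) (≡-sym (cong suc lower≡)) arrows-T'))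
    where
    lower≡ : suc (k + (5 + k + l)) ≡ k + (6 + k + l)
    lower≡ = ≡-sym (+-suc k (5 + k + l))

  sharp-T' : CliqueSizes k (k + n) → IsRamseyNumber (Tmi i m) (T' n) (m + n ∸ 4)
  sharp-T' sizes = isRamsey {Tmi i m} {T' n} arrows-T' (proj₁ (¬arrows-cliques sizes))

  sharp-T* : CliqueSizes k (k + n) → IsRamseyNumber (Tmi i m) (T* n) (m + n ∸ 4)
  sharp-T* sizes = isRamsey {Tmi i m} {T* n} arrows-T* (proj₂ (¬arrows-cliques sizes))

ramsey-T* : ∀ i k l → ¬ (4 + k ∣ 3 + k + l) → let m = 5 + k ; n = 6 + k + l in
  RamseyBetween (Tmi i m) (T* n) (m + n ∸ 6) (m + n ∸ 4)
-- The regular graph is the one built for n − 1, which needs n − 1 > m; for n = m + 1 two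
-- cliques K_{m−2} already attain the upper bound.
ramsey-T* i k zero ∤ = _ , sharp-T* (0 , 2 , identity k) , ∸-monoʳ-≤ (m + n) (m≤n+m 4 2) , ≤-refl
  where
  open Bounds i k zero ∤
  identity : ∀ k → k + (6 + k + 0) ≡ 0 * (4 + k) + 2 * (3 + k)
  identity = solve-∀
ramsey-T* i k (suc l) ∤ = subst₂ (RamseyBetween (Tmi i m) (T* n))
  (cong (_∸ 6) (lower≡ k l)) (upper≡ k l)
  (ramsey-exists {Tmi i m} {T* n} (Tmi? i m) (T*? n) 3 (k + (5 + k + l)) ¬arrows-regular
    (subst (λ N → Arrows N (Tmi i m) (T* n)) (≡-sym (upper≡ k l)) arrows-T*))
  where
  open Bounds i k (suc l) ∤
  lower≡ : ∀ k l → 7 + (k + (5 + k + l)) ≡ 5 + k + (6 + k + suc l)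
  lower≡ = solve-∀
  upper≡ : ∀ k l → 3 + (k + (5 + k + l)) ≡ suc (k + (6 + k + suc l))
  upper≡ = solve-∀
  size≡ : ∀ k l → 5 + k + (k + l) ≡ k + (5 + k + l)
  size≡ = solve-∀
  slack : ∀ k l → suc (k + (5 + k + l)) ≡ 3 + k + suc l + (2 + k)
  slack = solve-∀
  -- Now the order is `m + n − 7`, so at most `n − 4` non-neighbours remain, against the `n − 3` at
  -- the centre of `T*`.
  ¬arrows-regular : ¬ Arrows (k + (5 + k + l)) (Tmi i m) (T* n)
  ¬arrows-regular with subst (RegularUnion k) (size≡ k l) (regular-union k l)
  ... | G , free , nb = ¬arrows {H = T* n} i G free
    (λ c → ≤⇒≯ (T*-bound {G = G} nb c) (≤-reflexive (slack k l)))

theorem5p3 : (i : Fin 2) (m n : ℕ) → 5 ≤ m → m < n → ¬ ((m ∸ 1) ∣ (n ∸ 3)) →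
    (Σ ℕ λ r → IsRamseyNumber (Tmi i m) (T' n) r × m + n ∸ 5 ≤ r × r ≤ m + n ∸ 4)
    × (Σ ℕ λ r → IsRamseyNumber (Tmi i m) (T* n) r × m + n ∸ 6 ≤ r × r ≤ m + n ∸ 4)
    × ((k q a b : ℕ) → 1 ≤ k → 1 ≤ q → a ≤ m ∸ 3 → b ≤ m ∸ 2 →
    n ≡ k * (m ∸ 1) + b → n ≡ q * (m ∸ 2) + a →
    ((b ≡ 1 ⊎ b ≡ 2 ⊎ b ≡ 4)
    ⊎ (b ≡ 0 × k ≥ 3)
    ⊎ n ≥ (m ∸ 3) * (m ∸ 3) + 2
    ⊎ n ≥ (m * m ∸ 1) ∸ b * (m ∸ 2)
    ⊎ (a ≥ 3 × n ≥ (a ∸ 4) * (m ∸ 1) + 4)) →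
    IsRamseyNumber (Tmi i m) (T* n) (m + n ∸ 4)
    × IsRamseyNumber (Tmi i m) (T' n) (m + n ∸ 4))
theorem5p3 i m n 5≤m m<n ∤ with m≤n⇒∃[o]m+o≡n 5≤m | m≤n⇒∃[o]m+o≡n m<n
... | k , refl | l , refl = ramsey-T' , ramsey-T* i k l ∤ ,
  λ K q a b 1≤K _ _ b≤ n≡ n≡′ condition →
    let sizes = cliqueSizes k K q a b m<n 1≤K b≤ n≡ n≡′ condition in sharp-T* sizes , sharp-T' sizes
  where open Bounds i k l ∤
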